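{- Let $\mathcal{F}$ be a family of closure systems (on finite universes of unbounded cardinality) that enjoys the disjoint extension property, and let $c\ge 1$ be the corresponding exponent. Then there is an algorithm $\mathcal{A}$ which, for any closure system $\mathcal{C}\in\mathcal{F}$, $\mathcal{C}\subseteq \mathcal{P}([w])$, that comes equipped with an implicational base $\Sigma$ having $h\ge 1$ elements, and for any $k\in[w]$, enumerates the $N$ many sets $X\in\mathcal{C}$ with $|X|=k$ in output-polynomial time $$O\big((N+1)\,h\,s\,(hw+w^{c})\big),$$ where $s=\max\{|A|+1 : (A\to B)\in\Sigma\}$.
   Context: $[w]=\{1,2,\dots,w\}$ and $\mathcal{P}(W)$ is the powerset of $W$. A closure system on a finite set $W$ is a family $\mathcal{C}\subseteq\mathcal{P}(W)$ with $W\in\mathcal{C}$ and such that $X,Y\in\mathcal{C}$ implies $X\cap Y\in\mathcal{C}$. An implication on $W$ is a pair $A\to B$ with $A,B\subseteq W$; $A$ is its premise and $B$ its conclusion. A set $X\subseteq W$ satisfies $A\to B$ if $A\subseteq X$ implies $B\subseteq X$. For a family $\Sigma$ of implications, $\mathrm{Mod}(\Sigma)$ is the closure system of all $X\subseteq W$ that satisfy every member of $\Sigma$. $\Sigma$ is an implicational base of $\mathcal{C}$ if $\mathcal{C}=\mathrm{Mod}(\Sigma)$. Disjoint extension property of a family $\mathcal{F}$ of closure systems: there is $c\ge 1$ such that for all $\mathcal{C}\in\mathcal{F}$ (with universe $W$, $w=|W|$), all $Z_0\in\mathcal{C}$, all $Y\subseteq W$ and all $k\le w$, it can be checked in time $O(w^c)$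 whether there is $Z\in\mathcal{C}$ with $Z_0\subseteq Z$, $|Z|=k$ and $Y\cap Z=\emptyset$. To enumerate a collection of sets means to produce (list) all of them, one by one. -}

module Defs where

open import Data.Bool.Base using (Bool; true; false; if_then_else_)
open import Data.Fin.Subset using (Subset; ⊤; _∩_; _⊆_; ∣_∣; Empty)
open import Data.List.Base using (List; []; _∷_; length; map; drop; head)
open import Data.List.Extrema.Nat using (max)
open import Data.List.Relation.Unary.All using (All)
open import Data.List.Relation.Unary.Unique.Propositional using (Unique)
import Data.List.Membership.Propositional as List
open import Data.Maybe.Base using (Maybe; just)
open import Data.Nat.Base using (ℕ; zero; suc; _+_; _∸_; _*_; _^_; _≤_; _≡ᵇ_)
open import Data.Product.Base using (Σ-syntax; ∃; ∃-syntax; _×_)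
open import Data.Vec.Base using (toList)
open import Function.Bundles using (_⇔_)
open import Level using (0ℓ)
open import Relation.Binary.PropositionalEquality.Core using (_≡_)
open import Relation.Nullary.Decidable.Core using (Dec; does)
open import Relation.Unary using (Pred; _∈_; _≐_)

record ClosureSystem (w : ℕ) : Set₁ where
  field
    Closed   : Pred (Subset w) 0ℓ
    ⊤-closed : ⊤ ∈ Closed
    ∩-closed : ∀ {X Y} → X ∈ Closed → Y ∈ Closed → X ∩ Y ∈ Closed

open ClosureSystem public

record Implication (w : ℕ) : Set where
  constructor _⟶_
  field
    premise    : Subset w
    conclusion : Subset w

open Implication public

_Satisfies_ : ∀ {w} → Subset w → Implication w → Set
X Satisfies (A ⟶ B) = A ⊆ X → B ⊆ X

Mod : ∀ {w} → List (Implication w) → Pred (Subset w) 0ℓ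
Mod Γ X = All (X Satisfies_) Γ

_IsBaseOf_ : ∀ {w} → List (Implication w) → ClosureSystem w → Set
Γ IsBaseOf C = Closed C ≐ Mod Γ

maxPremise+1 : ∀ {w} → List (Implication w) → ℕ
maxPremise+1 Γ = max 0 (map (λ φ → ∣ premise φ ∣ + 1) Γ)

_Enumerates_ : ∀ {w} → List (Subset w) → Pred (Subset w) 0ℓ → Set
Xs Enumerates P = Unique Xs × (∀ X → X List.∈ Xs ⇔ X ∈ P)

-- A unit-cost random access machine (addition and truncated subtraction
-- as its only arithmetic), programmed through mutually recursive
-- first-order procedures.  A machine word is a number or a pointer to a
-- read-only block of words.  Every operation below takes a bounded
-- number of steps on a RAM, the bound depending on the program only, so
-- the size of an evaluation is the running time up to a constant factor.

data Val : Set where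
  nat   : ℕ → Val
  block : List Val → Val

data Expr : Set where
  var   : ℕ → Expr
  lit   : ℕ → Expr
  add   : Expr → Expr → Expr
  sub   : Expr → Expr → Expr
  ifz   : Expr → Expr → Expr → Expr   -- first branch on zero
  new   : List Expr → Expr            -- allocate a read-only block
  size  : Expr → Expr                 -- number of entries
  index : Expr → Expr → Expr          -- block, position (from 0)
  load  : Expr → Expr
  store : Expr → Expr → Expr          -- address, value; returns the value
  bind  : Expr → Expr → Expr          -- the bound value is var 0 in the body
  call  : ℕ → List Expr → Expr

-- call f refers to the entry f of procs; arguments are var 0, var 1, ….
record Program : Set where
  constructor program
  field
    procs : List Expr
    main  : Expr

open Program public

Env : Set
Env = List Val

Memory : Set
Memory = ℕ → Val

_[_≔_] : Memory → ℕ → Val → Memory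
(μ [ a ≔ v ]) b = if a ≡ᵇ b then v else μ b

infix 8 _‼_
_‼_ : ∀ {A : Set} → List A → ℕ → Maybe A
xs ‼ n = head (drop n xs)

-- Δ ⊢ ρ , μ , e ⇓ v , μ′ [ t ]: with procedures Δ, environment ρ and
-- memory μ, e evaluates to v in t steps and leaves the memory μ′.
-- Ill-typed or out-of-range operations have no rule and get stuck.
infix 4 _⊢_,_,_⇓_,_[_] _⊢_,_,_⇓*_,_[_]

data _⊢_,_,_⇓_,_[_] (Δ : List Expr) (ρ : Env) (μ : Memory)
     : Expr → Val → Memory → ℕ → Set

data _⊢_,_,_⇓*_,_[_] (Δ : List Expr) (ρ : Env) (μ : Memory)
     : List Expr → List Val → Memory → ℕ → Set

data _⊢_,_,_⇓_,_[_] Δ ρ μ where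
  ⇓var   : ∀ {x v} → ρ ‼ x ≡ just v →
           Δ ⊢ ρ , μ , var x ⇓ v , μ [ 1 ]
  ⇓lit   : ∀ {n} →
           Δ ⊢ ρ , μ , lit n ⇓ nat n , μ [ 1 ]
  ⇓add   : ∀ {d e m n μ₁ μ₂ s t} →
           Δ ⊢ ρ , μ , d ⇓ nat m , μ₁ [ s ] →
           Δ ⊢ ρ , μ₁ , e ⇓ nat n , μ₂ [ t ] →
           Δ ⊢ ρ , μ , add d e ⇓ nat (m + n) , μ₂ [ suc (s + t) ]
  ⇓sub   : ∀ {d e m n μ₁ μ₂ s t} →
           Δ ⊢ ρ , μ , d ⇓ nat m , μ₁ [ s ] →
           Δ ⊢ ρ , μ₁ , e ⇓ nat n , μ₂ [ t ] →
           Δ ⊢ ρ , μ , sub d e ⇓ nat (m ∸ n) , μ₂ [ suc (s + t) ]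
  ⇓ifz-0 : ∀ {c d e v μ₁ μ₂ s t} →
           Δ ⊢ ρ , μ , c ⇓ nat zero , μ₁ [ s ] →
           Δ ⊢ ρ , μ₁ , d ⇓ v , μ₂ [ t ] →
           Δ ⊢ ρ , μ , ifz c d e ⇓ v , μ₂ [ suc (s + t) ]
  ⇓ifz-+ : ∀ {c d e n v μ₁ μ₂ s t} →
           Δ ⊢ ρ , μ , c ⇓ nat (suc n) , μ₁ [ s ] →
           Δ ⊢ ρ , μ₁ , e ⇓ v , μ₂ [ t ] →
           Δ ⊢ ρ , μ , ifz c d e ⇓ v , μ₂ [ suc (s + t) ]
  ⇓new   : ∀ {es vs μ₁ t} →
           Δ ⊢ ρ , μ , es ⇓* vs , μ₁ [ t ] →
           Δ ⊢ ρ , μ , new es ⇓ block vs , μ₁ [ suc t ]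
  ⇓size  : ∀ {e vs μ₁ t} →
           Δ ⊢ ρ , μ , e ⇓ block vs , μ₁ [ t ] →
           Δ ⊢ ρ , μ , size e ⇓ nat (length vs) , μ₁ [ suc t ]
  ⇓index : ∀ {d e vs n v μ₁ μ₂ s t} →
           Δ ⊢ ρ , μ , d ⇓ block vs , μ₁ [ s ] →
           Δ ⊢ ρ , μ₁ , e ⇓ nat n , μ₂ [ t ] →
           vs ‼ n ≡ just v →
           Δ ⊢ ρ , μ , index d e ⇓ v , μ₂ [ suc (s + t) ]
  ⇓load  : ∀ {e a μ₁ t} →
           Δ ⊢ ρ , μ , e ⇓ nat a , μ₁ [ t ] →
           Δ ⊢ ρ , μ , load e ⇓ μ₁ a , μ₁ [ suc t ]
  ⇓store : ∀ {d e a v μ₁ μ₂ s t} →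
           Δ ⊢ ρ , μ , d ⇓ nat a , μ₁ [ s ] →
           Δ ⊢ ρ , μ₁ , e ⇓ v , μ₂ [ t ] →
           Δ ⊢ ρ , μ , store d e ⇓ v , μ₂ [ a ≔ v ] [ suc (s + t) ]
  ⇓bind  : ∀ {d e u v μ₁ μ₂ s t} →
           Δ ⊢ ρ , μ , d ⇓ u , μ₁ [ s ] →
           Δ ⊢ u ∷ ρ , μ₁ , e ⇓ v , μ₂ [ t ] →
           Δ ⊢ ρ , μ , bind d e ⇓ v , μ₂ [ suc (s + t) ]
  ⇓call  : ∀ {f es vs e v μ₁ μ₂ s t} →
           Δ ‼ f ≡ just e →
           Δ ⊢ ρ , μ , es ⇓* vs , μ₁ [ s ] →
           Δ ⊢ vs , μ₁ , e ⇓ v , μ₂ [ t ] →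
           Δ ⊢ ρ , μ , call f es ⇓ v , μ₂ [ suc (s + t) ]

data _⊢_,_,_⇓*_,_[_] Δ ρ μ where
  []  : Δ ⊢ ρ , μ , [] ⇓* [] , μ [ 0 ]
  _∷_ : ∀ {e es v vs μ₁ μ₂ s t} →
        Δ ⊢ ρ , μ , e ⇓ v , μ₁ [ s ] →
        Δ ⊢ ρ , μ₁ , es ⇓* vs , μ₂ [ t ] →
        Δ ⊢ ρ , μ , e ∷ es ⇓* v ∷ vs , μ₂ [ s + t ]

-- The memory is not assumed to be initialised: the result has to be the
-- same for all initial contents.
_On_Returns_Within_ : Program → List Val → Val → ℕ → Set
P On args Returns v Within b =
  ∀ μ → ∃[ μ′ ] ∃[ t ] (procs P ⊢ args , μ , main P ⇓ v , μ′ [ t ]) × t ≤ b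

encBool : Bool → Val
encBool false = nat 0
encBool true  = nat 1

encList : List Val → Val
encList []       = block []
encList (v ∷ vs) = block (v ∷ encList vs ∷ [])

encSubset : ∀ {w} → Subset w → Val
encSubset X = encList (map encBool (toList X))

encImplication : ∀ {w} → Implication w → Val
encImplication (A ⟶ B) = block (encSubset A ∷ encSubset B ∷ [])

encSubsets : ∀ {w} → List (Subset w) → Val
encSubsets Xs = encList (map encSubset Xs)

encImplications : ∀ {w} → List (Implication w) → Val
encImplications Γ = encList (map encImplication Γ)

-- A program can only work on a member of a family if the member is given
-- to it in some form (by a poset, a graph, a base, …).  This form is
-- arbitrary: code i is what a program sees of the member i.
record Family : Set₁ where
  field
    Index     : Set
    card      : Index → ℕ
    system    : (i : Index) → ClosureSystem (card i)
    code      : Index → Val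
    unbounded : ∀ n → ∃[ i ] n ≤ card i

open Family public

DisjointExtension : ∀ {w} → ClosureSystem w → (Z₀ Y : Subset w) → ℕ → Set
DisjointExtension C Z₀ Y k =
  ∃[ Z ] Z ∈ Closed C × Z₀ ⊆ Z × ∣ Z ∣ ≡ k × Empty (Y ∩ Z)

-- The empty universe is left out since w ^ c vanishes there; for positive
-- w, one constant K covers all w.
DisjointExtensionProperty : Family → ℕ → Set
DisjointExtensionProperty F c =
  1 ≤ c ×
  Σ[ P ∈ Program ] Σ[ K ∈ ℕ ]
    ∀ (i : Index F) → let w = card F i; C = system F i in
    1 ≤ w →
    ∀ (Z₀ Y : Subset w) (k : ℕ) → Z₀ ∈ Closed C → k ≤ w →
    Σ[ d ∈ Dec (DisjointExtension C Z₀ Y k) ]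
      P On code F i ∷ nat w ∷ encSubset Z₀ ∷ encSubset Y ∷ nat k ∷ []
        Returns encBool (does d) Within (K * w ^ c)

module Submission where

-- Keep a row (O , Y): the sets containing the closed set O and avoiding Y.
-- Branch on the elements a of the premises: either a joins Y, or O is
-- replaced by the closure of O ∪ {a}; the disjoint extension property tells
-- which of the two rows contains a solution, and only those are entered.
-- When all premise elements are decided, every X in the row is closed: a
-- premise A ⊆ X is disjoint from Y, hence A ⊆ O, so its conclusion is in
-- O ⊆ X.  Now the sets of size k in the row can be listed combinatorially.
-- There are at most Σ |A| ≤ h s levels, the rows of one level are disjoint
-- and nonempty, and each costs two tests and one closure, which takes O(h w)
-- steps if the missing elements of every premise are counted.

open import Defs
open import Data.Bool.Base using (Bool; true; false; T)
open import Data.Bool.Properties using (∨-zeroʳ; ∨-identityʳ)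
open import Data.Empty using (⊥-elim)
open import Data.Fin.Base using (Fin; zero; suc; toℕ)
open import Data.Fin.Subset using (Subset; ⊥; _∩_; _∪_; _─_; ∁; _⊆_; ∣_∣; Empty; ⁅_⁆) renaming (_∈_ to _∈ₛ_; _∉_ to _∉ₛ_)
open import Data.Fin.Subset.Properties
open import Data.List.Base using (List; []; _∷_; _++_; length; map; foldl)
open import Data.List.Extrema.Nat using (xs≤max)
open import Data.List.Membership.Propositional using () renaming (_∈_ to _∈ₗ_)
open import Data.List.Membership.Propositional.Properties using (∈-map⁺; ∈-map⁻; ∈-++⁺ˡ; ∈-++⁺ʳ; ∈-++⁻)
open import Data.List.Properties using (length-++; length-map; map-++)
open import Data.List.Relation.Unary.All as All using (All; []; _∷_)
open import Data.List.Relation.Unary.All.Properties using (map⁻)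
open import Data.List.Relation.Unary.AllPairs using ([]; _∷_)
open import Data.List.Relation.Unary.Any using (here; there)
import Data.List.Relation.Unary.Unique.Propositional.Properties as Unique
open import Data.Maybe.Base using (just)
open import Data.Nat.Base
open import Data.Nat.ListAction using (sum)
open import Data.Nat.ListAction.Properties using (sum-++)
open import Data.Nat.Properties
open import Data.Nat.Tactic.RingSolver using (solve-∀)
open import Data.Product.Base using (Σ-syntax; ∃-syntax; _×_; _,_; proj₁; proj₂)
open import Data.Sum.Base using (_⊎_; inj₁; inj₂)
open import Data.Vec.Base as Vec using (Vec; []; _∷_; toList; fromList; here; there)
open import Data.Vec.Properties using (∷-injectiveʳ)
open import Data.Vec.Relation.Binary.Pointwise.Inductive using (Pointwise; []; _∷_)
open import Function.Base using (_∘_; case_of_)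
open import Function.Bundles using (mk⇔; Equivalence)
open import Level using (0ℓ)
open import Relation.Binary.PropositionalEquality
open import Relation.Nullary.Decidable.Core using (Dec; yes; no; does)
open import Relation.Nullary.Negation using (¬_)
open import Relation.Unary using (Pred; _≐_; _∈_; ∅) renaming (_∪_ to _∪ₚ_)

-- The bound leaves only O(h w) steps for a closure, whereas passing over the whole base until
-- nothing changes costs that much per pass, with possibly one pass per new element. So closures are
-- computed in the style of LinClosure: an element is subtracted from the counters once, when it is
-- new. A row that is visited may turn out to be empty. Its test cannot be charged to a solution in
-- it and is charged to its parent, which contains one; hence the term `2 * q` in `searchUnit`. The
-- oracle may overwrite the memory, but promises its answer for every initial memory. Statements
-- about evaluations are therefore quantified over the memory, and the procedures added to those of
-- the oracle neither load nor store. Inequalities between costs become ring identities once the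
-- slack is exhibited, which is the purpose of `≤-slack`.

≤-slack : ∀ {m n} o → m + o ≡ n → m ≤ n
≤-slack o eq = ≤-trans (m≤m+n _ o) (≤-reflexive eq)

-- Evaluation with costs

mutual
  -- The procedures of the oracle stand first in the list of `algorithm`, so its calls keep their
  -- numbers and its evaluations survive at the same cost.
  ++-⇓ : ∀ {Δ ρ μ e v μ′ t} Δ′ → Δ ⊢ ρ , μ , e ⇓ v , μ′ [ t ] → Δ ++ Δ′ ⊢ ρ , μ , e ⇓ v , μ′ [ t ]
  ++-⇓ Δ′ (⇓var eq)        = ⇓var eq
  ++-⇓ Δ′ ⇓lit             = ⇓lit
  ++-⇓ Δ′ (⇓add d e)       = ⇓add (++-⇓ Δ′ d) (++-⇓ Δ′ e)
  ++-⇓ Δ′ (⇓sub d e)       = ⇓sub (++-⇓ Δ′ d) (++-⇓ Δ′ e)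
  ++-⇓ Δ′ (⇓ifz-0 c d)     = ⇓ifz-0 (++-⇓ Δ′ c) (++-⇓ Δ′ d)
  ++-⇓ Δ′ (⇓ifz-+ c e)     = ⇓ifz-+ (++-⇓ Δ′ c) (++-⇓ Δ′ e)
  ++-⇓ Δ′ (⇓new es)        = ⇓new (++-⇓* Δ′ es)
  ++-⇓ Δ′ (⇓size e)        = ⇓size (++-⇓ Δ′ e)
  ++-⇓ Δ′ (⇓index d e eq)  = ⇓index (++-⇓ Δ′ d) (++-⇓ Δ′ e) eq
  ++-⇓ Δ′ (⇓load e)        = ⇓load (++-⇓ Δ′ e)
  ++-⇓ Δ′ (⇓store d e)     = ⇓store (++-⇓ Δ′ d) (++-⇓ Δ′ e)
  ++-⇓ Δ′ (⇓bind d e)      = ⇓bind (++-⇓ Δ′ d) (++-⇓ Δ′ e)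
  ++-⇓ {Δ} Δ′ (⇓call {f} eq es e) = ⇓call (‼-++ˡ Δ f eq) (++-⇓* Δ′ es) (++-⇓ Δ′ e)
    where
    ‼-++ˡ : ∀ {A : Set} {x : A} xs {ys} n → xs ‼ n ≡ just x → (xs ++ ys) ‼ n ≡ just x
    ‼-++ˡ (x ∷ xs) zero    eq = eq
    ‼-++ˡ (x ∷ xs) (suc n) eq = ‼-++ˡ xs n eq
    ‼-++ˡ []       zero    ()
    ‼-++ˡ []       (suc n) ()

  ++-⇓* : ∀ {Δ ρ μ es vs μ′ t} Δ′ → Δ ⊢ ρ , μ , es ⇓* vs , μ′ [ t ] → Δ ++ Δ′ ⊢ ρ , μ , es ⇓* vs , μ′ [ t ]
  ++-⇓* Δ′ []       = []
  ++-⇓* Δ′ (e ∷ es) = ++-⇓ Δ′ e ∷ ++-⇓* Δ′ es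

‼-++ʳ : ∀ {A : Set} (xs : List A) {ys} n → (xs ++ ys) ‼ (length xs + n) ≡ ys ‼ n
‼-++ʳ []       n = refl
‼-++ʳ (x ∷ xs) n = ‼-++ʳ xs n

-- Bounds the steps of a procedure outside its calls.  Kept abstract so that
-- the costs, which are multiples of κ, are not unfolded.
abstract
  κ : ℕ
  κ = 100

  literal≤κ : ∀ {n} → T (n ≤ᵇ 100) → n ≤ κ
  literal≤κ = ≤ᵇ⇒≤ _ _

-- The text of the algorithm

data Name : Set where
  oracle union diff count insert replicate subtract decrement settle fire saturate close
    counters addRow columns positions branches consEach append enum visit search : Name

names : List Name
names = oracle ∷ union ∷ diff ∷ count ∷ insert ∷ replicate ∷ subtract ∷ decrement ∷ settle ∷ fire
  ∷ saturate ∷ close ∷ counters ∷ addRow ∷ columns ∷ positions ∷ branches ∷ consEach ∷ append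
  ∷ enum ∷ visit ∷ search ∷ []

position : Name → ℕ
position oracle    = 0
position union     = 1
position diff      = 2
position count     = 3
position insert    = 4
position replicate = 5
position subtract  = 6
position decrement = 7
position settle    = 8
position fire      = 9
position saturate  = 10
position close     = 11
position counters  = 12
position addRow    = 13
position columns   = 14
position positions = 15
position branches  = 16
position consEach  = 17
position append    = 18
position enum      = 19
position visit     = 20
position search    = 21

names‼position : ∀ {A : Set} (g : Name → A) f → map g names ‼ position f ≡ just (g f)
names‼position g oracle    = refl
names‼position g union     = refl
names‼position g diff      = refl
names‼position g count     = refl
names‼position g insert    = refl
names‼position g replicate = refl
names‼position g subtract  = refl
names‼position g decrement = refl
names‼position g settle    = refl
names‼position g fire      = refl
names‼position g saturate  = refl
names‼position g close     = refl
names‼position g counters  = refl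
names‼position g addRow    = refl
names‼position g columns   = refl
names‼position g positions = refl
names‼position g branches  = refl
names‼position g consEach  = refl
names‼position g append    = refl
names‼position g enum      = refl
names‼position g visit     = refl
names‼position g search    = refl

nil : Expr
nil = new []

cons : Expr → Expr → Expr
cons d e = new (d ∷ e ∷ [])

entry : ℕ → Expr → Expr
entry i e = index e (lit i)

hd tl : ℕ → Expr
hd x = entry 0 (var x)
tl x = entry 1 (var x)

ifnil : ℕ → Expr → Expr → Expr
ifnil x = ifz (size (var x))

module Machine (P : Program) where

  infix 9 _$_
  _$_ : Name → List Expr → Expr
  f $ es = call (length (procs P) + position f) es

  body : Name → Expr
  -- The main expression of the oracle becomes a procedure with a number of its own, placed after
  -- the procedures of `P`.
  body oracle = main P
  body union = ifnil 0 nil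
    (cons (ifz (hd 0) (hd 1) (lit 1)) (union $ (tl 0 ∷ tl 1 ∷ [])))
  body diff = ifnil 0 nil
    (cons (ifz (hd 1) (hd 0) (lit 0)) (diff $ (tl 0 ∷ tl 1 ∷ [])))
  body count = ifnil 0 (lit 0) (add (hd 0) (count $ (tl 0 ∷ [])))
  body insert = ifz (var 0) (cons (lit 1) (tl 1))
    (cons (hd 1) (insert $ (sub (var 0) (lit 1) ∷ tl 1 ∷ [])))
  body replicate = ifz (var 0) nil
    (cons (var 1) (replicate $ (sub (var 0) (lit 1) ∷ var 1 ∷ [])))
  body subtract = ifnil 0 nil
    (cons (sub (hd 0) (hd 1)) (subtract $ (tl 0 ∷ tl 1 ∷ [])))
  body decrement = ifnil 0 (var 2)
    (decrement $ (tl 0 ∷ tl 1 ∷ ifz (hd 0) (var 2) (subtract $ (var 2 ∷ hd 1 ∷ [])) ∷ []))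
  body settle = ifnil 0 nil
    (cons (ifz (sub (hd 0) (lit 1)) (lit 0) (hd 0)) (settle $ (tl 0 ∷ [])))
  body fire = ifnil 0 (var 2) (fire $ (tl 0 ∷ tl 1 ∷
    -- As `sub` truncates, the inner test succeeds for the counters 0 and 1; the outer test has
    -- already removed 0.
    ifz (hd 0) (var 2)
      (ifz (sub (hd 0) (lit 1)) (union $ (var 2 ∷ entry 1 (hd 1) ∷ [])) (var 2)) ∷ []))
  body saturate =
    bind (decrement $ (var 1 ∷ var 3 ∷ var 2 ∷ []))
    (bind (fire $ (var 0 ∷ var 5 ∷ var 1 ∷ []))
    (bind (diff $ (var 0 ∷ var 2 ∷ []))
    -- The environment is now `D′`, `X′`, `cs₁`, `X`, `D`, `cs`, the columns, `Γ`. An empty `D′`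
    -- means that the round has added nothing.
    (ifz (count $ (var 0 ∷ [])) (var 1)
      (saturate $ (var 1 ∷ var 0 ∷ settle $ (var 2 ∷ []) ∷ var 6 ∷ var 7 ∷ [])))))
  body close = saturate $ (var 0 ∷ var 0 ∷
    entry 4 (var 1) ∷ entry 3 (var 1) ∷ entry 5 (var 1) ∷ [])
  body counters = ifnil 0 nil
    (cons (add (lit 1) (count $ (entry 0 (hd 0) ∷ []))) (counters $ (tl 0 ∷ [])))
  body addRow = ifnil 0 nil
    (cons (cons (hd 0) (hd 1)) (addRow $ (tl 0 ∷ tl 1 ∷ [])))
  body columns = ifnil 0 (replicate $ (var 1 ∷ nil ∷ []))
    (addRow $ (entry 0 (hd 0) ∷ columns $ (tl 0 ∷ var 1 ∷ []) ∷ []))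
  body positions = ifnil 0 (var 2)
    (bind (positions $ (tl 0 ∷ add (lit 1) (var 1) ∷ var 2 ∷ []))
      (ifz (hd 1) (var 0) (cons (var 2) (var 0))))
  body branches = ifnil 0 nil
    (positions $ (entry 0 (hd 0) ∷ lit 0 ∷ branches $ (tl 0 ∷ []) ∷ []))
  -- The last argument is the list in front of which the results are put, so the two halves of a
  -- free position are joined without a further pass. This is the origin of the `++ []` in
  -- `fillings`.
  body consEach = ifnil 1 (var 2)
    (cons (cons (var 0) (hd 1)) (consEach $ (var 0 ∷ tl 1 ∷ var 2 ∷ [])))
  body append = ifnil 0 (var 1) (cons (hd 0) (append $ (tl 0 ∷ var 1 ∷ [])))
  body enum = ifnil 0 (cons nil nil)
    (ifz (hd 0)
      (ifz (hd 1)
        (consEach $ (lit 1 ∷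
          ifz (var 2) nil (enum $ (tl 0 ∷ tl 1 ∷ sub (var 2) (lit 1) ∷ var 3 ∷ [])) ∷
          consEach $ (lit 0 ∷
            ifz (var 3) nil (enum $ (tl 0 ∷ tl 1 ∷ var 2 ∷ sub (var 3) (lit 1) ∷ [])) ∷
            nil ∷ []) ∷ []))
        (consEach $ (lit 0 ∷ enum $ (tl 0 ∷ tl 1 ∷ var 2 ∷ var 3 ∷ []) ∷ nil ∷ [])))
      (consEach $ (lit 1 ∷ enum $ (tl 0 ∷ tl 1 ∷ var 2 ∷ var 3 ∷ []) ∷ nil ∷ [])))
  body visit = ifz
    (oracle $ (entry 0 (var 3) ∷ entry 1 (var 3) ∷ var 1 ∷ var 2 ∷ entry 2 (var 3) ∷ []))
    nil (search $ (var 0 ∷ var 1 ∷ var 2 ∷ var 3 ∷ []))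
  body search = ifnil 0
    (enum $ (var 1 ∷ var 2 ∷
      -- Among the free positions, k - |O| are to be true and w - |Y| - k are to be false.
      sub (entry 2 (var 3)) (count $ (var 1 ∷ [])) ∷
      sub (sub (entry 1 (var 3)) (count $ (var 2 ∷ []))) (entry 2 (var 3)) ∷ []))
    (append $
      (visit $ (tl 0 ∷ var 1 ∷ insert $ (hd 0 ∷ var 2 ∷ []) ∷ var 3 ∷ []) ∷
       visit $ (tl 0 ∷ close $ (insert $ (hd 0 ∷ var 1 ∷ []) ∷ var 3 ∷ []) ∷ var 2 ∷ var 3 ∷ []) ∷
       []))

  algorithm : Program
  algorithm = program (procs P ++ map body names)
    -- The context passed to every visit: code, w, k, columns, initial counters, base. The tables
    -- are built only once.
    (bind (new (var 0 ∷ var 1 ∷ var 3 ∷ columns $ (var 2 ∷ var 1 ∷ []) ∷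
      counters $ (var 2 ∷ []) ∷ var 2 ∷ []))
    (bind (replicate $ (var 2 ∷ lit 0 ∷ []))
    (visit $ (branches $ (var 4 ∷ []) ∷ close $ (var 0 ∷ var 1 ∷ []) ∷ var 0 ∷ var 1 ∷ []))))

  private
    Δ : List Expr
    Δ = procs algorithm

    Δ‼ : ∀ f → Δ ‼ (length (procs P) + position f) ≡ just (body f)
    Δ‼ f = trans (‼-++ʳ (procs P) (position f)) (names‼position body f)

  -- A calculus of evaluations with cost bounds

  -- n counts the steps outside calls, bs lists bounds for the calls.  With the
  -- two kept apart, n computes to a numeral.
  record Eval (ρ : Env) (e : Expr) (v : Val) (n : ℕ) (bs : List ℕ) : Set where
    constructor eval
    field
      run : ∀ μ → ∃[ μ′ ] ∃[ t ] (Δ ⊢ ρ , μ , e ⇓ v , μ′ [ t ]) × t ≤ n + sum bs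

  record Evals (ρ : Env) (es : List Expr) (vs : List Val) (n : ℕ) (bs : List ℕ) : Set where
    constructor evals
    field
      run : ∀ μ → ∃[ μ′ ] ∃[ t ] (Δ ⊢ ρ , μ , es ⇓* vs , μ′ [ t ]) × t ≤ n + sum bs

  private
    joint : ∀ {s t m n} as {bs} → s ≤ m + sum as → t ≤ n + sum bs → s + t ≤ (m + n) + sum (as ++ bs)
    joint {s} {t} {m} {n} as {bs} p q = begin
      s + t                          ≤⟨ +-mono-≤ p q ⟩
      (m + sum as) + (n + sum bs)    ≡⟨ lemma m (sum as) n (sum bs) ⟩
      (m + n) + (sum as + sum bs)    ≡⟨ cong (m + n +_) (sum-++ as bs) ⟨
      (m + n) + sum (as ++ bs)       ∎
      where
      open ≤-Reasoning
      lemma : ∀ a b c d → (a + b) + (c + d) ≡ (a + c) + (b + d)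
      lemma = solve-∀

  module _ {ρ : Env} where

    evar : ∀ {x v} → ρ ‼ x ≡ just v → Eval ρ (var x) v 1 []
    evar eq .Eval.run μ = _ , _ , ⇓var eq , ≤-refl

    elit : ∀ {n} → Eval ρ (lit n) (nat n) 1 []
    elit .Eval.run μ = _ , _ , ⇓lit , ≤-refl

    eadd : ∀ {d e i j m n as bs} → Eval ρ d (nat i) m as → Eval ρ e (nat j) n bs →
           Eval ρ (add d e) (nat (i + j)) (suc (m + n)) (as ++ bs)
    eadd {as = as} (eval p) (eval q) .Eval.run μ =
      let μ₁ , _ , D , D≤ = p μ ; μ₂ , _ , E , E≤ = q μ₁
      in _ , _ , ⇓add D E , s≤s (joint as D≤ E≤)

    esub : ∀ {d e i j m n as bs} → Eval ρ d (nat i) m as → Eval ρ e (nat j) n bs →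
           Eval ρ (sub d e) (nat (i ∸ j)) (suc (m + n)) (as ++ bs)
    esub {as = as} (eval p) (eval q) .Eval.run μ =
      let μ₁ , _ , D , D≤ = p μ ; μ₂ , _ , E , E≤ = q μ₁
      in _ , _ , ⇓sub D E , s≤s (joint as D≤ E≤)

    eif0 : ∀ {c d e v m n as bs} → Eval ρ c (nat 0) m as → Eval ρ d v n bs →
           Eval ρ (ifz c d e) v (suc (m + n)) (as ++ bs)
    eif0 {as = as} (eval p) (eval q) .Eval.run μ =
      let μ₁ , _ , D , D≤ = p μ ; μ₂ , _ , E , E≤ = q μ₁
      in _ , _ , ⇓ifz-0 D E , s≤s (joint as D≤ E≤)

    eif+ : ∀ {c d e i v m n as bs} → Eval ρ c (nat (suc i)) m as → Eval ρ e v n bs →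
           Eval ρ (ifz c d e) v (suc (m + n)) (as ++ bs)
    eif+ {as = as} (eval p) (eval q) .Eval.run μ =
      let μ₁ , _ , D , D≤ = p μ ; μ₂ , _ , E , E≤ = q μ₁
      in _ , _ , ⇓ifz-+ D E , s≤s (joint as D≤ E≤)

    enew : ∀ {es vs n bs} → Evals ρ es vs n bs → Eval ρ (new es) (block vs) (suc n) bs
    enew (evals p) .Eval.run μ = let _ , _ , D , D≤ = p μ in _ , _ , ⇓new D , s≤s D≤

    esize : ∀ {e vs n bs} → Eval ρ e (block vs) n bs → Eval ρ (size e) (nat (length vs)) (suc n) bs
    esize (eval p) .Eval.run μ = let _ , _ , D , D≤ = p μ in _ , _ , ⇓size D , s≤s D≤

    eentry : ∀ {i e vs v n bs} → Eval ρ e (block vs) n bs → vs ‼ i ≡ just v →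
             Eval ρ (entry i e) v (suc (suc n)) bs
    eentry {n = n} {bs} (eval p) eq .Eval.run μ =
      let _ , t , D , D≤ = p μ
      in _ , _ , ⇓index D ⇓lit eq , s≤s (≤-trans (≤-reflexive (+-comm t 1)) (s≤s D≤))

    ebind : ∀ {d e u v m n as bs} → Eval ρ d u m as → Eval (u ∷ ρ) e v n bs →
            Eval ρ (bind d e) v (suc (m + n)) (as ++ bs)
    ebind {as = as} (eval p) (eval q) .Eval.run μ =
      let μ₁ , _ , D , D≤ = p μ ; μ₂ , _ , E , E≤ = q μ₁
      in _ , _ , ⇓bind D E , s≤s (joint as D≤ E≤)

    infixr 5 _▹_
    ∎ₑ : Evals ρ [] [] 0 []
    ∎ₑ .Evals.run μ = _ , _ , [] , ≤-refl

    _▹_ : ∀ {e es v vs m n as bs} → Eval ρ e v m as → Evals ρ es vs n bs →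
          Evals ρ (e ∷ es) (v ∷ vs) (m + n) (as ++ bs)
    _▹_ {as = as} (eval p) (evals q) .Evals.run μ =
      let μ₁ , _ , D , D≤ = p μ ; μ₂ , _ , E , E≤ = q μ₁
      in _ , _ , D ∷ E , joint as D≤ E≤

  record Runs (f : Name) (args : List Val) (v : Val) (b : ℕ) : Set where
    constructor runs
    field
      run : ∀ μ → ∃[ μ′ ] ∃[ t ] (Δ ⊢ args , μ , body f ⇓ v , μ′ [ t ]) × t ≤ b

  private
    foldl-+ : ∀ m as → foldl _+_ m as ≡ m + sum as
    foldl-+ m []       = sym (+-identityʳ m)
    foldl-+ m (a ∷ as) = trans (foldl-+ (m + a) as) (+-assoc m a (sum as))

    ≤-foldl : ∀ {t n} bs → T (n ≤ᵇ 100) → t ≤ n + sum bs → t ≤ foldl _+_ κ bs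
    ≤-foldl {t} {n} bs n≤ t≤ = begin
      t                  ≤⟨ t≤ ⟩
      n + sum bs         ≤⟨ +-monoˡ-≤ (sum bs) (literal≤κ n≤) ⟩
      κ + sum bs         ≡⟨ foldl-+ κ bs ⟨
      foldl _+_ κ bs     ∎
      where open ≤-Reasoning

  -- `foldl` instead of `sum` turns the list of call bounds into a left-nested sum that starts with
  -- `κ` and has no trailing 0, the shape in which the cost lemmas are stated. Since `n` is a
  -- numeral, the hidden argument is found by computation.
  within : ∀ {f args v n bs b} → Eval args (body f) v n bs → {T (n ≤ᵇ 100)} →
           foldl _+_ κ bs ≤ b → Runs f args v b
  within {bs = bs} (eval p) {n≤} ≤b .Runs.run μ =
    let _ , _ , D , D≤ = p μ in _ , _ , D , ≤-trans (≤-foldl bs n≤ D≤) ≤b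

  returns : ∀ {args v n bs b} → Eval args (main algorithm) v n bs → {T (n ≤ᵇ 100)} →
            foldl _+_ κ bs ≤ b → algorithm On args Returns v Within b
  returns {bs = bs} (eval p) {n≤} ≤b μ =
    let _ , _ , D , D≤ = p μ in _ , _ , D , ≤-trans (≤-foldl bs n≤ D≤) ≤b

  runs-oracle : ∀ {args v b} → P On args Returns v Within b → Runs oracle args v b
  runs-oracle p .Runs.run μ = let _ , _ , D , D≤ = p μ in _ , _ , ++-⇓ (map body names) D , D≤

  -- Lets a branch without a call have the cost list of one with a call.
  idle : ∀ {ρ e v n bs} → Eval ρ e v n bs → Eval ρ e v n (0 ∷ bs)
  idle (eval p) = eval p

  module _ {ρ : Env} where

    ecall : ∀ {f es vs v n as b} → Runs f vs v b → Evals ρ es vs n as →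
            Eval ρ (f $ es) v (suc n) (as ++ b ∷ [])
    ecall {f} {n = n} {as} {b} (runs p) (evals q) .Eval.run μ =
      let μ₁ , _ , D , D≤ = q μ ; μ₂ , _ , E , E≤ = p μ₁
      in _ , _ , ⇓call (Δ‼ f) D E , s≤s (≤-trans (joint as D≤ (≤-trans E≤ (m≤m+n b 0)))
           (≤-reflexive (cong (_+ sum (as ++ _)) (+-identityʳ n))))

    ehd : ∀ {x u v} → ρ ‼ x ≡ just (block (u ∷ v ∷ [])) → Eval ρ (hd x) u 3 []
    ehd eq = eentry (evar eq) refl

    etl : ∀ {x u v} → ρ ‼ x ≡ just (block (u ∷ v ∷ [])) → Eval ρ (tl x) v 3 []
    etl eq = eentry (evar eq) refl

    enil : Eval ρ nil (block []) 1 []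
    enil = enew ∎ₑ

    econs : ∀ {d e u v m n as bs} → Eval ρ d u m as → Eval ρ e v n bs →
            Eval ρ (cons d e) (block (u ∷ v ∷ [])) (suc (m + (n + 0))) (as ++ bs ++ [])
    econs p q = enew (p ▹ q ▹ ∎ₑ)

    eifnil : ∀ {x d e v n bs} → ρ ‼ x ≡ just (block []) → Eval ρ d v n bs →
             Eval ρ (ifnil x d e) v (3 + n) bs
    eifnil eq p = eif0 (esize (evar eq)) p

    eifcons : ∀ {x d e u u′ v n bs} → ρ ‼ x ≡ just (block (u ∷ u′ ∷ [])) → Eval ρ e v n bs →
              Eval ρ (ifnil x d e) v (3 + n) bs
    eifcons eq p = eif+ (esize (evar eq)) p

-- The procedures

-- The counter of an implication is 0 when it has fired, and otherwise one more
-- than the number of premise elements still to be subtracted.  So 1 means that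
-- it can fire.

bit : Bool → ℕ
bit false = 0
bit true  = 1

lower : ∀ {h} → Vec ℕ h → Subset h → Vec ℕ h
lower = Vec.zipWith (λ c b → c ∸ bit b)

lowerAll : ∀ {n h} → Subset n → Vec (Subset h) n → Vec ℕ h → Vec ℕ h
lowerAll []          []           cs = cs
lowerAll (false ∷ D) (col ∷ cols) cs = lowerAll D cols cs
lowerAll (true ∷ D)  (col ∷ cols) cs = lowerAll D cols (lower cs col)

settled : ℕ → ℕ
settled 1 = 0
settled c = c

-- A conclusion added during the pass does not affect the counters of the implications after it; it
-- reaches them in the next round, as part of the new elements.
fireAll : ∀ {w} (Γ : List (Implication w)) → Vec ℕ (length Γ) → Subset w → Subset w
fireAll []      []                  X = X
fireAll (φ ∷ Γ) (zero ∷ cs)         X = fireAll Γ cs X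
fireAll (φ ∷ Γ) (suc zero ∷ cs)     X = fireAll Γ cs (X ∪ conclusion φ)
fireAll (φ ∷ Γ) (suc (suc c) ∷ cs)  X = fireAll Γ cs X

ready : ∀ {h} → Vec ℕ h → ℕ
ready []           = 0
ready (1 ∷ cs)     = suc (ready cs)
ready (_ ∷ cs)     = ready cs

initial : ∀ {w} (Γ : List (Implication w)) → Vec ℕ (length Γ)
initial []      = []
initial (φ ∷ Γ) = suc ∣ premise φ ∣ ∷ initial Γ

-- The incidence matrix of premises and elements, by columns: a new element is handled by
-- subtracting one column from the vector of counters.
transposed : ∀ {w} (Γ : List (Implication w)) → Vec (Subset (length Γ)) w
transposed []      = Vec.replicate _ []
transposed (φ ∷ Γ) = Vec.zipWith _∷_ (premise φ) (transposed Γ)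

elements : ∀ {n} → Subset n → List (Fin n)
elements []          = []
elements (false ∷ X) = map suc (elements X)
elements (true ∷ X)  = zero ∷ map suc (elements X)

premiseElements : ∀ {w} → List (Implication w) → List (Fin w)
premiseElements []      = []
premiseElements (φ ∷ Γ) = elements (premise φ) ++ premiseElements Γ

-- r free positions get true and g get false.  If r + g is the number of free
-- positions, then no recursive call comes back empty.
fillings : ∀ {n} → Subset n → Subset n → ℕ → ℕ → List (Subset n)
fillings₁ fillings₀ : ∀ {n} → Subset n → Subset n → ℕ → ℕ → List (Subset n)
fillings []          []          r g = [] ∷ []
fillings (true ∷ O)  (y ∷ Y)     r g = map (true ∷_) (fillings O Y r g) ++ []
fillings (false ∷ O) (true ∷ Y)  r g = map (false ∷_) (fillings O Y r g) ++ []
fillings (false ∷ O) (false ∷ Y) r g =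
  map (true ∷_) (fillings₁ O Y r g) ++ (map (false ∷_) (fillings₀ O Y r g) ++ [])
fillings₁ O Y zero    g = []
fillings₁ O Y (suc r) g = fillings O Y r g
fillings₀ O Y r zero    = []
fillings₀ O Y r (suc g) = fillings O Y r g

encNats : List ℕ → Val
encNats ns = encList (map nat ns)

encCounters : ∀ {h} → Vec ℕ h → Val
encCounters cs = encNats (toList cs)

encColumns : ∀ {n h} → Vec (Subset h) n → Val
encColumns cols = encList (map encSubset (toList cols))

encFins : ∀ {n} → List (Fin n) → Val
encFins as = encNats (map toℕ as)

-- A traversal in which every marked position causes one further call of cost `a * k`. It serves
-- both `decrement`, where the elements of `D` are marked, and `fire`, where the ready implications
-- are.
charge : ∀ k a m d → (k + a * k) + (m + d * a) * k ≡ (suc m + suc d * a) * k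
charge = solve-∀

nil-cost : ∀ w → κ ≤ 1 * (2 * suc w * κ)
nil-cost w = ≤-slack (κ + 2 * w * κ) (identity κ w)
  where
  identity : ∀ k w → k + (k + 2 * w * k) ≡ 1 * (2 * suc w * k)
  identity = solve-∀

cons-cost : ∀ w h → κ + h * (2 * suc w * κ) + suc w * κ ≤ suc h * (2 * suc w * κ)
cons-cost w h = ≤-slack (w * κ) (identity κ w h)
  where
  identity : ∀ k w h → (k + h * (2 * suc w * k) + suc w * k) + w * k ≡ suc h * (2 * suc w * k)
  identity = solve-∀

map-+-suc : ∀ {n} m (as : List (Fin n)) →
  map (λ a → m + toℕ a) (map suc as) ≡ map (λ a → suc m + toℕ a) as
map-+-suc m []       = refl
map-+-suc m (a ∷ as) = cong₂ _∷_ (+-suc m (toℕ a)) (map-+-suc m as)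

module Procedures (P : Program) where
  open Machine P

  runs-union : ∀ {n} (X Y : Subset n) →
    Runs union (encSubset X ∷ encSubset Y ∷ []) (encSubset (X ∪ Y)) (suc n * κ)
  runs-union []          []      = within (eifnil refl enil) (m≤m+n κ 0)
  runs-union (false ∷ X) (y ∷ Y) = within (eifcons refl (econs (eif0 (ehd refl) (ehd refl))
    (ecall (runs-union X Y) (etl refl ▹ etl refl ▹ ∎ₑ)))) ≤-refl
  runs-union (true ∷ X)  (y ∷ Y) = within (eifcons refl (econs (eif+ (ehd refl) elit)
    (ecall (runs-union X Y) (etl refl ▹ etl refl ▹ ∎ₑ)))) ≤-refl

  runs-diff : ∀ {n} (X Y : Subset n) →
    Runs diff (encSubset X ∷ encSubset Y ∷ []) (encSubset (X ─ Y)) (suc n * κ)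
  runs-diff []      []          = within (eifnil refl enil) (m≤m+n κ 0)
  runs-diff (x ∷ X) (false ∷ Y) = within (eifcons refl (econs (eif0 (ehd refl) (ehd refl))
    (ecall (runs-diff X Y) (etl refl ▹ etl refl ▹ ∎ₑ)))) ≤-refl
  runs-diff (x ∷ X) (true ∷ Y)  = within (eifcons refl (econs (eif+ (ehd refl) elit)
    (ecall (runs-diff X Y) (etl refl ▹ etl refl ▹ ∎ₑ)))) ≤-refl

  runs-count : ∀ {n} (X : Subset n) →
    Runs count (encSubset X ∷ []) (nat ∣ X ∣) (suc n * κ)
  runs-count []          = within (eifnil refl elit) (m≤m+n κ 0)
  runs-count (false ∷ X) = within (eifcons refl (eadd (ehd refl)
    (ecall (runs-count X) (etl refl ▹ ∎ₑ)))) ≤-refl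
  runs-count (true ∷ X)  = within (eifcons refl (eadd (ehd refl)
    (ecall (runs-count X) (etl refl ▹ ∎ₑ)))) ≤-refl

  runs-insert : ∀ {n} (a : Fin n) (X : Subset n) →
    Runs insert (nat (toℕ a) ∷ encSubset X ∷ []) (encSubset (X ∪ ⁅ a ⁆)) (suc n * κ)
  runs-insert zero (x ∷ X) rewrite ∪-identityʳ X | ∨-zeroʳ x =
    within (eif0 (evar refl) (econs elit (etl refl))) (m≤m+n κ _)
  runs-insert (suc a) (x ∷ X) rewrite ∨-identityʳ x =
    within (eif+ (evar refl) (econs (ehd refl)
      (ecall (runs-insert a X) (esub (evar refl) elit ▹ etl refl ▹ ∎ₑ)))) ≤-refl

  runs-replicate : ∀ n v →
    Runs replicate (nat n ∷ v ∷ []) (encList (toList (Vec.replicate n v))) (suc n * κ)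
  runs-replicate zero    v = within (eif0 (evar refl) enil) (m≤m+n κ 0)
  runs-replicate (suc n) v = within (eif+ (evar refl) (econs (evar refl)
    (ecall (runs-replicate n v) (esub (evar refl) elit ▹ evar refl ▹ ∎ₑ)))) ≤-refl

  runs-subtract : ∀ {h} (cs : Vec ℕ h) (col : Subset h) →
    Runs subtract (encCounters cs ∷ encSubset col ∷ []) (encCounters (lower cs col)) (suc h * κ)
  runs-subtract []       []            = within (eifnil refl enil) (m≤m+n κ 0)
  runs-subtract (c ∷ cs) (false ∷ col) = within (eifcons refl (econs (esub (ehd refl) (ehd refl))
    (ecall (runs-subtract cs col) (etl refl ▹ etl refl ▹ ∎ₑ)))) ≤-refl
  runs-subtract (c ∷ cs) (true ∷ col)  = within (eifcons refl (econs (esub (ehd refl) (ehd refl))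
    (ecall (runs-subtract cs col) (etl refl ▹ etl refl ▹ ∎ₑ)))) ≤-refl

  runs-decrement : ∀ {n h} (D : Subset n) (cols : Vec (Subset h) n) (cs : Vec ℕ h) →
    Runs decrement (encSubset D ∷ encColumns cols ∷ encCounters cs ∷ [])
      (encCounters (lowerAll D cols cs)) ((suc n + ∣ D ∣ * suc h) * κ)
  runs-decrement []          []           cs = within (eifnil refl (evar refl)) (m≤m+n κ 0)
  runs-decrement (false ∷ D) (col ∷ cols) cs = within (eifcons refl
    (ecall (runs-decrement D cols cs)
      (etl refl ▹ etl refl ▹ eif0 (ehd refl) (evar refl) ▹ ∎ₑ))) ≤-refl
  runs-decrement {suc n} {h} (true ∷ D) (col ∷ cols) cs = within (eifcons refl
    (ecall (runs-decrement D cols (lower cs col))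
      (etl refl ▹ etl refl ▹
        eif+ (ehd refl) (ecall (runs-subtract cs col) (evar refl ▹ ehd refl ▹ ∎ₑ)) ▹ ∎ₑ)))
    (≤-reflexive (charge κ (suc h) (suc n) ∣ D ∣))

  runs-settle : ∀ {h} (cs : Vec ℕ h) →
    Runs settle (encCounters cs ∷ []) (encCounters (Vec.map settled cs)) (suc h * κ)
  runs-settle []                 = within (eifnil refl enil) (m≤m+n κ 0)
  runs-settle (zero ∷ cs)        = within (eifcons refl (econs
    (eif0 (esub (ehd refl) elit) elit)
    (ecall (runs-settle cs) (etl refl ▹ ∎ₑ)))) ≤-refl
  runs-settle (suc zero ∷ cs)    = within (eifcons refl (econs
    (eif0 (esub (ehd refl) elit) elit)
    (ecall (runs-settle cs) (etl refl ▹ ∎ₑ)))) ≤-refl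
  runs-settle (suc (suc c) ∷ cs) = within (eifcons refl (econs
    (eif+ (esub (ehd refl) elit) (ehd refl))
    (ecall (runs-settle cs) (etl refl ▹ ∎ₑ)))) ≤-refl

  runs-fire : ∀ {w} (Γ : List (Implication w)) (cs : Vec ℕ (length Γ)) (X : Subset w) →
    Runs fire (encCounters cs ∷ encImplications Γ ∷ encSubset X ∷ [])
      (encSubset (fireAll Γ cs X)) ((suc (length Γ) + ready cs * suc w) * κ)
  runs-fire []      []                 X = within (eifnil refl (evar refl)) (m≤m+n κ 0)
  runs-fire (φ ∷ Γ) (zero ∷ cs)        X = within (eifcons refl
    (ecall (runs-fire Γ cs X) (etl refl ▹ etl refl ▹ eif0 (ehd refl) (evar refl) ▹ ∎ₑ))) ≤-refl
  runs-fire {w} (φ ∷ Γ) (suc zero ∷ cs) X = within (eifcons refl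
    (ecall (runs-fire Γ cs (X ∪ conclusion φ)) (etl refl ▹ etl refl ▹
      eif+ (ehd refl) (eif0 (esub (ehd refl) elit)
        (ecall (runs-union X (conclusion φ)) (evar refl ▹ eentry (ehd refl) refl ▹ ∎ₑ))) ▹ ∎ₑ)))
    (≤-reflexive (charge κ (suc w) (suc (length Γ)) (ready cs)))
  runs-fire (φ ∷ Γ) (suc (suc c) ∷ cs) X = within (eifcons refl
    (ecall (runs-fire Γ cs X) (etl refl ▹ etl refl ▹
      eif+ (ehd refl) (eif+ (esub (ehd refl) elit) (evar refl)) ▹ ∎ₑ))) ≤-refl

  runs-counters : ∀ {w} (Γ : List (Implication w)) →
    Runs counters (encImplications Γ ∷ []) (encCounters (initial Γ)) (suc (length Γ) * (2 * suc w * κ))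
  runs-counters {w} []      = within (eifnil refl enil) (nil-cost w)
  runs-counters {w} (φ ∷ Γ) = within (eifcons refl (econs
    (eadd elit (ecall (runs-count (premise φ)) (eentry (ehd refl) refl ▹ ∎ₑ)))
    (ecall (runs-counters Γ) (etl refl ▹ ∎ₑ))))
    (≤-slack (w * κ) (cost κ w (suc (length Γ))))
    where
    cost : ∀ k a h → ((k + suc a * k) + h * (2 * suc a * k)) + a * k ≡ suc h * (2 * suc a * k)
    cost = solve-∀

  runs-addRow : ∀ {n h} (X : Subset n) (cols : Vec (Subset h) n) →
    Runs addRow (encSubset X ∷ encColumns cols ∷ []) (encColumns (Vec.zipWith _∷_ X cols)) (suc n * κ)
  runs-addRow []      []           = within (eifnil refl enil) (m≤m+n κ 0)
  runs-addRow (x ∷ X) (col ∷ cols) = within (eifcons refl (econs (econs (ehd refl) (ehd refl))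
    (ecall (runs-addRow X cols) (etl refl ▹ etl refl ▹ ∎ₑ)))) ≤-refl

  runs-columns : ∀ {w} (Γ : List (Implication w)) →
    Runs columns (encImplications Γ ∷ nat w ∷ []) (encColumns (transposed Γ)) (suc (length Γ) * (2 * suc w * κ))
  runs-columns {w} []      = within (eifnil refl
    (ecall (subst (λ v → Runs replicate (nat w ∷ block [] ∷ []) v (suc w * κ)) (replicated w)
        (runs-replicate w (block [])))
      (evar refl ▹ enil ▹ ∎ₑ)))
    (≤-slack (w * κ) (cost κ w))
    where
    cost : ∀ k a → (k + suc a * k) + a * k ≡ 1 * (2 * suc a * k)
    cost = solve-∀
    replicated : ∀ n → encList (toList (Vec.replicate n (block []))) ≡ encColumns (Vec.replicate n [])
    replicated zero    = refl
    replicated (suc n) = cong (λ v → block (block [] ∷ v ∷ [])) (replicated n)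
  runs-columns {w} (φ ∷ Γ) = within (eifcons refl
    (ecall (runs-addRow (premise φ) (transposed Γ)) (eentry (ehd refl) refl ▹
      ecall (runs-columns Γ) (etl refl ▹ evar refl ▹ ∎ₑ) ▹ ∎ₑ)))
    (cons-cost w (suc (length Γ)))

  runs-positions : ∀ {n} (X : Subset n) m {as} →
    Runs positions (encSubset X ∷ nat m ∷ encNats as ∷ [])
      (encNats (map (λ a → m + toℕ a) (elements X) ++ as)) (suc n * κ)
  runs-positions []      m = within (eifnil refl (evar refl)) (m≤m+n κ 0)
  -- The equation aligns the positions `m + toℕ (suc a)` with those of the recursive call, which
  -- starts at `suc m`.
  runs-positions (x ∷ X) m {as} with runs-positions X (suc m) {as} | map-+-suc m (elements X)
  runs-positions (false ∷ X) m | IH | eq rewrite eq = within (eifcons refl (ebind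
    (ecall IH (etl refl ▹ eadd elit (evar refl) ▹ evar refl ▹ ∎ₑ))
    (eif0 (ehd refl) (evar refl)))) ≤-refl
  runs-positions (true ∷ X) m | IH | eq rewrite eq | +-identityʳ m = within (eifcons refl (ebind
    (ecall IH (etl refl ▹ eadd elit (evar refl) ▹ evar refl ▹ ∎ₑ))
    (eif+ (ehd refl) (econs (evar refl) (evar refl))))) ≤-refl

  runs-branches : ∀ {w} (Γ : List (Implication w)) →
    Runs branches (encImplications Γ ∷ []) (encFins (premiseElements Γ)) (suc (length Γ) * (2 * suc w * κ))
  runs-branches {w} []      = within (eifnil refl enil) (nil-cost w)
  runs-branches {w} (φ ∷ Γ) rewrite map-++ toℕ (elements (premise φ)) (premiseElements Γ) = within (eifcons refl
    (ecall (runs-positions (premise φ) 0 {map toℕ (premiseElements Γ)})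
      (eentry (ehd refl) refl ▹ elit ▹ ecall (runs-branches Γ) (etl refl ▹ ∎ₑ) ▹ ∎ₑ)))
    (cons-cost w (suc (length Γ)))

  runs-consEach : ∀ {n} b (Xs : List (Subset n)) {Ys : List (Subset (suc n))} →
    Runs consEach (encBool b ∷ encSubsets Xs ∷ encSubsets Ys ∷ [])
      (encSubsets (map (b ∷_) Xs ++ Ys)) (suc (length Xs) * κ)
  runs-consEach b []       = within (eifnil refl (evar refl)) (m≤m+n κ 0)
  runs-consEach b (X ∷ Xs) = within (eifcons refl (econs (econs (evar refl) (ehd refl))
    (ecall (runs-consEach b Xs) (evar refl ▹ etl refl ▹ evar refl ▹ ∎ₑ)))) ≤-refl

  runs-append : ∀ {n} (Xs : List (Subset n)) {Ys : List (Subset n)} →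
    Runs append (encSubsets Xs ∷ encSubsets Ys ∷ []) (encSubsets (Xs ++ Ys)) (suc (length Xs) * κ)
  runs-append []       = within (eifnil refl (evar refl)) (m≤m+n κ 0)
  runs-append (X ∷ Xs) = within (eifcons refl (econs (ehd refl)
    (ecall (runs-append Xs) (etl refl ▹ evar refl ▹ ∎ₑ)))) ≤-refl

-- Closures in linear time

∣p∣≡0⇒x∉p : ∀ {n} {p : Subset n} {x} → ∣ p ∣ ≡ 0 → x ∉ₛ p
∣p∣≡0⇒x∉p {p = false ∷ p} eq (there x∈p) = ∣p∣≡0⇒x∉p eq x∈p
∣p∣≡0⇒x∉p {p = true ∷ p}  ()

∣p─q∣≡0⇒p⊆q : ∀ {n} (p q : Subset n) → ∣ p ─ q ∣ ≡ 0 → p ⊆ q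
∣p─q∣≡0⇒p⊆q p q eq {x} x∈p with x ∈? q
... | yes x∈q = x∈q
... | no x∉q  = ⊥-elim (∣p∣≡0⇒x∉p eq (x∈p∧x∉q⇒x∈p─q x∈p x∉q))

p⊆q⇒∣p─q∣≡0 : ∀ {n} (p q : Subset n) → p ⊆ q → ∣ p ─ q ∣ ≡ 0
p⊆q⇒∣p─q∣≡0 []          []          p⊆q = refl
p⊆q⇒∣p─q∣≡0 (x ∷ p)     (true ∷ q)  p⊆q = p⊆q⇒∣p─q∣≡0 p q (drop-∷-⊆ p⊆q)
p⊆q⇒∣p─q∣≡0 (false ∷ p) (false ∷ q) p⊆q = p⊆q⇒∣p─q∣≡0 p q (drop-∷-⊆ p⊆q)
p⊆q⇒∣p─q∣≡0 (true ∷ p)  (false ∷ q) p⊆q = case p⊆q here of λ ()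

∣p─q∣+∣p∩q∣≡∣p∣ : ∀ {n} (p q : Subset n) → ∣ p ─ q ∣ + ∣ p ∩ q ∣ ≡ ∣ p ∣
∣p─q∣+∣p∩q∣≡∣p∣ []          []          = refl
∣p─q∣+∣p∩q∣≡∣p∣ (false ∷ p) (false ∷ q) = ∣p─q∣+∣p∩q∣≡∣p∣ p q
∣p─q∣+∣p∩q∣≡∣p∣ (false ∷ p) (true ∷ q)  = ∣p─q∣+∣p∩q∣≡∣p∣ p q
∣p─q∣+∣p∩q∣≡∣p∣ (true ∷ p)  (false ∷ q) = cong suc (∣p─q∣+∣p∩q∣≡∣p∣ p q)
∣p─q∣+∣p∩q∣≡∣p∣ (true ∷ p)  (true ∷ q)  = trans (+-suc _ _) (cong suc (∣p─q∣+∣p∩q∣≡∣p∣ p q))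

-- Carries a counter into the next round: for a premise p and a round from q to r, what was missing
-- splits into what is still missing and what has yet to be subtracted.
∣p─r∣+∣p∩[r─q]∣≡∣p─q∣ : ∀ {n} (p q r : Subset n) → q ⊆ r → ∣ p ─ r ∣ + ∣ p ∩ (r ─ q) ∣ ≡ ∣ p ─ q ∣
∣p─r∣+∣p∩[r─q]∣≡∣p─q∣ []          []          []          q⊆r = refl
∣p─r∣+∣p∩[r─q]∣≡∣p─q∣ (p ∷ ps)    (true ∷ q)  (false ∷ r) q⊆r = case q⊆r here of λ ()
∣p─r∣+∣p∩[r─q]∣≡∣p─q∣ (false ∷ p) (true ∷ q)  (true ∷ r)  q⊆r = ∣p─r∣+∣p∩[r─q]∣≡∣p─q∣ p q r (drop-∷-⊆ q⊆r)
∣p─r∣+∣p∩[r─q]∣≡∣p─q∣ (true ∷ p)  (true ∷ q)  (true ∷ r)  q⊆r = ∣p─r∣+∣p∩[r─q]∣≡∣p─q∣ p q r (drop-∷-⊆ q⊆r)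
∣p─r∣+∣p∩[r─q]∣≡∣p─q∣ (false ∷ p) (false ∷ q) (false ∷ r) q⊆r = ∣p─r∣+∣p∩[r─q]∣≡∣p─q∣ p q r (drop-∷-⊆ q⊆r)
∣p─r∣+∣p∩[r─q]∣≡∣p─q∣ (true ∷ p)  (false ∷ q) (false ∷ r) q⊆r = cong suc (∣p─r∣+∣p∩[r─q]∣≡∣p─q∣ p q r (drop-∷-⊆ q⊆r))
∣p─r∣+∣p∩[r─q]∣≡∣p─q∣ (false ∷ p) (false ∷ q) (true ∷ r)  q⊆r = ∣p─r∣+∣p∩[r─q]∣≡∣p─q∣ p q r (drop-∷-⊆ q⊆r)
∣p─r∣+∣p∩[r─q]∣≡∣p─q∣ (true ∷ p)  (false ∷ q) (true ∷ r)  q⊆r =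
  trans (+-suc _ _) (cong suc (∣p─r∣+∣p∩[r─q]∣≡∣p─q∣ p q r (drop-∷-⊆ q⊆r)))

pending : ∀ {h} → Vec ℕ h → ℕ
pending []           = 0
pending (zero ∷ cs)  = pending cs
pending (suc c ∷ cs) = suc (pending cs)

pending-∷ : ∀ {h a b} {as bs : Vec ℕ h} → a ≤ b → pending as ≤ pending bs → pending (a ∷ as) ≤ pending (b ∷ bs)
pending-∷ {b = zero}  z≤n     p = p
pending-∷ {b = suc b} z≤n     p = m≤n⇒m≤1+n p
pending-∷             (s≤s _) p = s≤s p

pending-lower : ∀ {h} (cs : Vec ℕ h) col → pending (lower cs col) ≤ pending cs
pending-lower []       []        = z≤n
pending-lower (c ∷ cs) (b ∷ col) = pending-∷ (m∸n≤m c (bit b)) (pending-lower cs col)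

pending-lowerAll : ∀ {n h} (D : Subset n) cols (cs : Vec ℕ h) → pending (lowerAll D cols cs) ≤ pending cs
pending-lowerAll []          []           cs = ≤-refl
pending-lowerAll (false ∷ D) (col ∷ cols) cs = pending-lowerAll D cols cs
pending-lowerAll (true ∷ D)  (col ∷ cols) cs = ≤-trans (pending-lowerAll D cols (lower cs col)) (pending-lower cs col)

pending-settled : ∀ {h} (cs : Vec ℕ h) → pending (Vec.map settled cs) + ready cs ≡ pending cs
pending-settled []                 = refl
pending-settled (zero ∷ cs)        = pending-settled cs
pending-settled (suc zero ∷ cs)    = trans (+-suc _ _) (cong suc (pending-settled cs))
pending-settled (suc (suc c) ∷ cs) = cong suc (pending-settled cs)

lowerAll-∷ : ∀ {n h} (D A : Subset n) (cols : Vec (Subset h) n) c cs →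
  lowerAll D (Vec.zipWith _∷_ A cols) (c ∷ cs) ≡ (c ∸ ∣ A ∩ D ∣) ∷ lowerAll D cols cs
lowerAll-∷ []          []          []           c cs = refl
lowerAll-∷ (false ∷ D) (false ∷ A) (col ∷ cols) c cs = lowerAll-∷ D A cols c cs
lowerAll-∷ (false ∷ D) (true ∷ A)  (col ∷ cols) c cs = lowerAll-∷ D A cols c cs
lowerAll-∷ (true ∷ D)  (false ∷ A) (col ∷ cols) c cs = lowerAll-∷ D A cols c (lower cs col)
lowerAll-∷ (true ∷ D)  (true ∷ A)  (col ∷ cols) c cs = trans (lowerAll-∷ D A cols (c ∸ 1) (lower cs col))
  (cong (_∷ lowerAll D cols (lower cs col)) (∸-+-assoc c 1 ∣ A ∩ D ∣))

-- Invariants of the counters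

Done : ∀ {w} → Subset w → Implication w → ℕ → Set
Done X φ c = c ≡ 0 × conclusion φ ⊆ X

-- D is the part of X that has not been subtracted from the counters.
Waiting : ∀ {w} → Subset w → Subset w → Implication w → ℕ → Set
Waiting X D φ c = Done X φ c ⊎ c ≡ suc (∣ premise φ ─ X ∣ + ∣ premise φ ∩ D ∣)

-- The state after `D` has been subtracted: an implication that is not done has counter 1 exactly
-- when its premise lies in `X`.
Updated : ∀ {w} → Subset w → Implication w → ℕ → Set
Updated X φ c = Done X φ c ⊎ c ≡ suc ∣ premise φ ─ X ∣

-- Nothing has been subtracted at the start, so all of `X` plays the role of `D`.
waiting-initial : ∀ {w} (X : Subset w) Γ → Pointwise (Waiting X X) (fromList Γ) (initial Γ)
waiting-initial X []      = []
waiting-initial X (φ ∷ Γ) = inj₂ (cong suc (sym (∣p─q∣+∣p∩q∣≡∣p∣ (premise φ) X))) ∷ waiting-initial X Γ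

updated : ∀ {w} {X : Subset w} D {Γ cs} → Pointwise (Waiting X D) (fromList Γ) cs →
  Pointwise (Updated X) (fromList Γ) (lowerAll D (transposed Γ) cs)
updated D {[]}    {[]}     []       = lemma D
  where
  lemma : ∀ {n} (D : Subset n) {w} {R : Implication w → ℕ → Set} → Pointwise R [] (lowerAll D (Vec.replicate n []) [])
  lemma []          = []
  lemma (false ∷ D) = lemma D
  lemma (true ∷ D)  = lemma D
updated {X = X} D {φ ∷ Γ} {c ∷ cs} (p ∷ ps) rewrite lowerAll-∷ D (premise φ) (transposed Γ) c cs =
  lemma p ∷ updated D ps
  where
  lemma : ∀ {c} → Waiting X D φ c → Updated X φ (c ∸ ∣ premise φ ∩ D ∣)
  -- Truncation keeps the counter of a fired implication at 0.
  lemma (inj₁ (refl , B⊆X)) = inj₁ (0∸n≡0 ∣ premise φ ∩ D ∣ , B⊆X)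
  lemma (inj₂ refl)         = inj₂ (m+n∸n≡m (suc ∣ premise φ ─ X ∣) ∣ premise φ ∩ D ∣)

⊆-fireAll : ∀ {w} (Γ : List (Implication w)) cs {X} → X ⊆ fireAll Γ cs X
⊆-fireAll []      []                 x∈X = x∈X
⊆-fireAll (φ ∷ Γ) (zero ∷ cs)        x∈X = ⊆-fireAll Γ cs x∈X
⊆-fireAll (φ ∷ Γ) (suc zero ∷ cs)    x∈X = ⊆-fireAll Γ cs (p⊆p∪q (conclusion φ) x∈X)
⊆-fireAll (φ ∷ Γ) (suc (suc c) ∷ cs) x∈X = ⊆-fireAll Γ cs x∈X

-- `X₀` is the set to which the counters refer and stays fixed while `X` grows in the pass. Counter
-- 1 puts the premise inside `X₀`, hence inside the model `Z`.
fireAll-⊆ : ∀ {w} {X₀ Z : Subset w} Γ {cs X} → Pointwise (Updated X₀) (fromList Γ) cs →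
  X₀ ⊆ Z → Mod Γ Z → X ⊆ Z → fireAll Γ cs X ⊆ Z
fireAll-⊆ []      {[]}               []       X₀⊆Z []       X⊆Z = X⊆Z
fireAll-⊆ (φ ∷ Γ) {zero ∷ cs}        (p ∷ ps) X₀⊆Z (_ ∷ zs) X⊆Z = fireAll-⊆ Γ ps X₀⊆Z zs X⊆Z
fireAll-⊆ {X₀ = X₀} (φ ∷ Γ) {suc zero ∷ cs} {X} (inj₂ eq ∷ ps) X₀⊆Z (z ∷ zs) X⊆Z =
  fireAll-⊆ Γ ps X₀⊆Z zs λ x∈ → case x∈p∪q⁻ X (conclusion φ) x∈ of λ
    { (inj₁ x∈X) → X⊆Z x∈X
    ; (inj₂ x∈B) → z (X₀⊆Z ∘ ∣p─q∣≡0⇒p⊆q (premise φ) X₀ (suc-injective (sym eq))) x∈B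
    }
fireAll-⊆ (φ ∷ Γ) {suc zero ∷ cs}    (inj₁ () ∷ ps)
fireAll-⊆ (φ ∷ Γ) {suc (suc c) ∷ cs} (p ∷ ps) X₀⊆Z (_ ∷ zs) X⊆Z = fireAll-⊆ Γ ps X₀⊆Z zs X⊆Z

fired : ∀ {w} (Γ : List (Implication w)) cs {X} →
  Pointwise (λ φ c → c ≡ 1 → conclusion φ ⊆ fireAll Γ cs X) (fromList Γ) cs
fired []      []                 = []
fired (φ ∷ Γ) (zero ∷ cs)        = (λ ()) ∷ fired Γ cs
fired (φ ∷ Γ) (suc zero ∷ cs) {X} = (λ _ x∈B → ⊆-fireAll Γ cs (q⊆p∪q X (conclusion φ) x∈B)) ∷ fired Γ cs
fired (φ ∷ Γ) (suc (suc c) ∷ cs) = (λ ()) ∷ fired Γ cs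

-- Ensures that a round with a new element has also fired an implication, so that both can pay for
-- it.
none-ready : ∀ {w} (Γ : List (Implication w)) cs {X} → ready cs ≡ 0 → fireAll Γ cs X ≡ X
none-ready []      []                 eq = refl
none-ready (φ ∷ Γ) (zero ∷ cs)        eq = none-ready Γ cs eq
none-ready (φ ∷ Γ) (suc (suc c) ∷ cs) eq = none-ready Γ cs eq

-- Restores the invariant for the next round. An implication with counter 1 has just put its
-- conclusion into `X′` and becomes done; a larger counter is split into missing and new elements.
waiting-settled : ∀ {w} {X X′ : Subset w} → X ⊆ X′ → ∀ Γ {cs} →
  Pointwise (Updated X) (fromList Γ) cs →
  Pointwise (λ φ c → c ≡ 1 → conclusion φ ⊆ X′) (fromList Γ) cs →
  Pointwise (Waiting X′ (X′ ─ X)) (fromList Γ) (Vec.map settled cs)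
waiting-settled {X = X} {X′} X⊆X′ = go
  where
  step : ∀ {φ c} → Updated X φ c → (c ≡ 1 → conclusion φ ⊆ X′) → Waiting X′ (X′ ─ X) φ (settled c)
  step {c = zero}        (inj₁ (_ , B⊆X)) B⊆X′ = inj₁ (refl , X⊆X′ ∘ B⊆X)
  step {c = suc zero}    p                B⊆X′ = inj₁ (refl , B⊆X′ refl)
  step {φ} {suc (suc c)} (inj₂ eq)        B⊆X′ =
    inj₂ (trans eq (cong suc (sym (∣p─r∣+∣p∩[r─q]∣≡∣p─q∣ (premise φ) X X′ X⊆X′))))
  go : ∀ Γ {cs : Vec ℕ (length Γ)} → Pointwise (Updated X) (fromList Γ) cs →
    Pointwise (λ φ c → c ≡ 1 → conclusion φ ⊆ X′) (fromList Γ) cs →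
    Pointwise (Waiting X′ (X′ ─ X)) (fromList Γ) (Vec.map settled cs)
  go []      []       []       = []
  go (φ ∷ Γ) (p ∷ ps) (q ∷ qs) = step {φ} p q ∷ go Γ ps qs

-- If the round has added nothing, a premise inside `X′` is inside `X`, so its implication is done
-- or has counter 1; either way the conclusion is in `X′`.
satisfied : ∀ {w} {X X′ : Subset w} → X ⊆ X′ → X′ ⊆ X → ∀ Γ {cs} →
  Pointwise (Updated X) (fromList Γ) cs →
  Pointwise (λ φ c → c ≡ 1 → conclusion φ ⊆ X′) (fromList Γ) cs →
  Mod Γ X′
satisfied {X = X} {X′} X⊆X′ X′⊆X = go
  where
  step : ∀ {φ c} → Updated X φ c → (c ≡ 1 → conclusion φ ⊆ X′) → X′ Satisfies φ
  step (inj₁ (_ , B⊆X)) B⊆X′ A⊆X′ = X⊆X′ ∘ B⊆X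
  step {φ} (inj₂ eq)    B⊆X′ A⊆X′ = B⊆X′ (trans eq (cong suc (p⊆q⇒∣p─q∣≡0 (premise φ) X (X′⊆X ∘ A⊆X′))))
  go : ∀ Γ {cs : Vec ℕ (length Γ)} → Pointwise (Updated X) (fromList Γ) cs →
    Pointwise (λ φ c → c ≡ 1 → conclusion φ ⊆ X′) (fromList Γ) cs → Mod Γ X′
  go []      []       []       = []
  go (φ ∷ Γ) (p ∷ ps) (q ∷ qs) = step {φ} p q ∷ go Γ ps qs

record IsClosure {w} (Γ : List (Implication w)) (X X̂ : Subset w) : Set where
  field
    ⊇      : X ⊆ X̂
    closed : Mod Γ X̂
    least  : ∀ {Z} → X ⊆ Z → Mod Γ Z → X̂ ⊆ Z

∣∁q∣+∣q─p∣≡∣∁p∣ : ∀ {n} (p q : Subset n) → p ⊆ q → ∣ ∁ q ∣ + ∣ q ─ p ∣ ≡ ∣ ∁ p ∣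
∣∁q∣+∣q─p∣≡∣∁p∣ []          []           p⊆q = refl
∣∁q∣+∣q─p∣≡∣∁p∣ (true ∷ p)  (false ∷ q) p⊆q = case p⊆q here of λ ()
∣∁q∣+∣q─p∣≡∣∁p∣ (true ∷ p)  (true ∷ q)  p⊆q = ∣∁q∣+∣q─p∣≡∣∁p∣ p q (drop-∷-⊆ p⊆q)
∣∁q∣+∣q─p∣≡∣∁p∣ (false ∷ p) (false ∷ q) p⊆q = cong suc (∣∁q∣+∣q─p∣≡∣∁p∣ p q (drop-∷-⊆ p⊆q))
∣∁q∣+∣q─p∣≡∣∁p∣ (false ∷ p) (true ∷ q)  p⊆q = trans (+-suc _ _) (cong suc (∣∁q∣+∣q─p∣≡∣∁p∣ p q (drop-∷-⊆ p⊆q)))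

-- m elements are outside X, and u implications have not fired.  A round that is
-- not the last one is paid by a new element and a fired implication.
saturateCost : (h w m d u : ℕ) → ℕ
saturateCost h w m d u = (2 * h * m + h * d + 2 * w * u + h + w) * (4 * κ)

-- `h` and `w` are successors of the actual sizes. At the start, `m` and `d` are below `w` and `u`
-- is below `h`, so every term of `saturateCost` is bounded by a multiple of `h * w`.
closeCost : (h w : ℕ) → ℕ
closeCost h w = 33 * (h * w) * κ

module Closing (P : Program) where
  open Machine P
  open Procedures P

  -- The set grows from call to call, so the recursion is on `m`, a bound for the number of elements
  -- still outside.
  runs-saturate : ∀ {w} (Γ : List (Implication w)) m X D cs → ∣ ∁ X ∣ ≤ m →
    Pointwise (Waiting X D) (fromList Γ) cs →
    ∃[ X̂ ] IsClosure Γ X X̂ ×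
      Runs saturate
        (encSubset X ∷ encSubset D ∷ encCounters cs ∷ encColumns (transposed Γ) ∷ encImplications Γ ∷ [])
        (encSubset X̂) (saturateCost (suc (length Γ)) (suc w) (∣ ∁ X ∣) (∣ D ∣) (pending cs))
  runs-saturate {w} Γ m X D cs ∁X≤m waits = proceed m ∁X≤m _ refl _ refl
    where
    cs₁ = lowerAll D (transposed Γ) cs
    X′  = fireAll Γ cs₁ X
    D′  = X′ ─ X
    h′  = suc (length Γ)
    w′  = suc w

    X⊆X′ : X ⊆ X′
    X⊆X′ = ⊆-fireAll Γ cs₁

    ups : Pointwise (Updated X) (fromList Γ) cs₁
    ups = updated D waits

    Goal : Set
    Goal = ∃[ X̂ ] IsClosure Γ X X̂ ×
      Runs saturate
        (encSubset X ∷ encSubset D ∷ encCounters cs ∷ encColumns (transposed Γ) ∷ encImplications Γ ∷ [])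
        (encSubset X̂) (saturateCost h′ w′ (∣ ∁ X ∣) (∣ D ∣) (pending cs))

    ready≤ : pending (Vec.map settled cs₁) + ready cs₁ ≤ pending cs
    ready≤ = ≤-trans (≤-reflexive (pending-settled cs₁)) (pending-lowerAll D (transposed Γ) cs)

    stop-cost : ∀ k h b m d u r → r ≤ u →
      let a = suc h in
      k + (b + d * a) * k + (a + r * b) * k + b * k + b * k ≤ (2 * a * m + a * d + 2 * b * u + a + b) * (4 * k)
    stop-cost k h b m d u r r≤u with e , refl ← m≤n⇒∃[o]m+o≡n r≤u =
      ≤-slack _ (identity k h b m d e r)
      where
      identity : ∀ k h b m d e r → let a = suc h in
        (k + (b + d * a) * k + (a + r * b) * k + b * k + b * k)
          + (8 * a * m + 3 * a * d + 7 * b * r + 8 * b * e + 3 * h + 2 + b) * k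
        ≡ (2 * a * m + a * d + 2 * b * (r + e) + a + b) * (4 * k)
      identity = solve-∀

    -- The d′ new elements release `2 * a * d′`: one half is the term `a * d′` of the next round,
    -- the other half pays for the passes of length `a`. The old term `a * d` pays for the columns,
    -- and the r fired implications release `2 * b * r`, which covers their unions and the passes of
    -- length `b`, as r ≥ 1.
    step-cost : ∀ k h b m d u m′ d′ u′ r {d″ r′} → d′ ≡ suc d″ → r ≡ suc r′ →
      m′ + d′ ≡ m → u′ + r ≤ u → let a = suc h in
      k + (b + d * a) * k + (a + r * b) * k + b * k + b * k + a * k
        + (2 * a * m′ + a * d′ + 2 * b * u′ + a + b) * (4 * k)
      ≤ (2 * a * m + a * d + 2 * b * u + a + b) * (4 * k)
    step-cost k h b _ d u m′ _ u′ _ {d′} {r} refl refl refl u≥ with e , refl ← m≤n⇒∃[o]m+o≡n u≥ =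
      ≤-slack _ (identity k h b d m′ d′ u′ r e)
      where
      identity : ∀ k h b d m′ d′ u′ r e → let a = suc h in
        (k + (b + d * a) * k + (a + suc r * b) * k + b * k + b * k + a * k
          + (2 * a * m′ + a * suc d′ + 2 * b * u′ + a + b) * (4 * k))
          + (2 * h + 1 + 4 * a * d′ + 3 * a * d + 4 * b + 7 * b * r + 8 * b * e) * k
        ≡ (2 * a * (m′ + suc d′) + a * d + 2 * b * (u′ + suc r + e) + a + b) * (4 * k)
      identity = solve-∀

    nothing-ready : ∀ {d} → ready cs₁ ≡ 0 → ∣ D′ ∣ ≢ suc d
    nothing-ready eq D′≡ = case trans (sym D′≡) (trans
      (cong (λ Y → ∣ Y ─ X ∣) (none-ready Γ cs₁ eq)) (p⊆q⇒∣p─q∣≡0 X X λ x∈X → x∈X)) of λ ()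

    ∁X≡ : ∀ {d} → ∣ D′ ∣ ≡ suc d → suc (∣ ∁ X′ ∣ + d) ≡ ∣ ∁ X ∣
    ∁X≡ {d} D′≡ = trans (sym (+-suc ∣ ∁ X′ ∣ d))
      (trans (cong (∣ ∁ X′ ∣ +_) (sym D′≡)) (∣∁q∣+∣q─p∣≡∣∁p∣ X X′ X⊆X′))

    counting : ∀ {d} → ∣ D′ ∣ ≡ d → Runs count (encSubset D′ ∷ []) (nat d) (w′ * κ)
    counting refl = runs-count D′

    proceed : ∀ m → ∣ ∁ X ∣ ≤ m → ∀ d → ∣ D′ ∣ ≡ d → ∀ r → ready cs₁ ≡ r → Goal
    proceed m ∁X≤m zero D′≡ _ _ = X′ , record
        { ⊇      = X⊆X′
        ; closed = satisfied X⊆X′ (∣p─q∣≡0⇒p⊆q X′ X D′≡) Γ ups (fired Γ cs₁)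
        ; least  = λ X⊆Z modZ → fireAll-⊆ Γ ups X⊆Z modZ X⊆Z
        } , within (ebind (ecall (runs-decrement D (transposed Γ) cs) (evar refl ▹ evar refl ▹ evar refl ▹ ∎ₑ))
          (ebind (ecall (runs-fire Γ cs₁ X) (evar refl ▹ evar refl ▹ evar refl ▹ ∎ₑ))
          (ebind (ecall (runs-diff X′ X) (evar refl ▹ evar refl ▹ ∎ₑ))
          (eif0 (ecall (counting D′≡) (evar refl ▹ ∎ₑ))
            (evar refl)))))
          (stop-cost κ (length Γ) w′ (∣ ∁ X ∣) (∣ D ∣) (pending cs) (ready cs₁)
            (≤-trans (m≤n+m (ready cs₁) _) ready≤))
    proceed m       ∁X≤m (suc d) D′≡ zero    r≡ = ⊥-elim (nothing-ready r≡ D′≡)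
    proceed zero    ∁X≤m (suc d) D′≡ (suc r) r≡ = case subst (_≤ 0) (sym (∁X≡ D′≡)) ∁X≤m of λ ()
    proceed (suc m) ∁X≤m (suc d) D′≡ (suc r) r≡ = X̂ , record
        { ⊇      = ⊇ ∘ X⊆X′
        ; closed = closed
        ; least  = λ X⊆Z modZ → least (fireAll-⊆ Γ ups X⊆Z modZ X⊆Z) modZ
        } , within (ebind (ecall (runs-decrement D (transposed Γ) cs) (evar refl ▹ evar refl ▹ evar refl ▹ ∎ₑ))
          (ebind (ecall (runs-fire Γ cs₁ X) (evar refl ▹ evar refl ▹ evar refl ▹ ∎ₑ))
          (ebind (ecall (runs-diff X′ X) (evar refl ▹ evar refl ▹ ∎ₑ))
          (eif+ (ecall (counting D′≡) (evar refl ▹ ∎ₑ))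
            (ecall rec (evar refl ▹ evar refl ▹
              ecall (runs-settle cs₁) (evar refl ▹ ∎ₑ) ▹ evar refl ▹ evar refl ▹ ∎ₑ))))))
          (step-cost κ (length Γ) w′ (∣ ∁ X ∣) (∣ D ∣) (pending cs) (∣ ∁ X′ ∣) (∣ D′ ∣) (pending cs₂) (ready cs₁)
            D′≡ r≡ (∣∁q∣+∣q─p∣≡∣∁p∣ X X′ X⊆X′) ready≤)
      where
      cs₂ = Vec.map settled cs₁

      IH = runs-saturate Γ m X′ D′ cs₂
        (≤-trans (m≤m+n ∣ ∁ X′ ∣ d) (s≤s⁻¹ (subst (_≤ suc m) (sym (∁X≡ D′≡)) ∁X≤m)))
        (waiting-settled X⊆X′ Γ ups (fired Γ cs₁))
      X̂ = proj₁ IH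
      open IsClosure (proj₁ (proj₂ IH))
      rec = proj₂ (proj₂ IH)

  runs-close : ∀ {w} (Γ : List (Implication w)) (X : Subset w) {u₀ u₁ u₂} →
    ∃[ X̂ ] IsClosure Γ X X̂ ×
      Runs close (encSubset X ∷ block (u₀ ∷ u₁ ∷ u₂ ∷ encColumns (transposed Γ) ∷
          encCounters (initial Γ) ∷ encImplications Γ ∷ []) ∷ [])
        (encSubset X̂) (closeCost (suc (length Γ)) (suc w))
  runs-close {w} Γ X =
    let X̂ , isClosure , rec = runs-saturate Γ w X X (initial Γ) (∣p∣≤n (∁ X)) (waiting-initial X Γ)
    in X̂ , isClosure , within
      (ecall rec (evar refl ▹ evar refl ▹ eentry (evar refl) refl ▹ eentry (evar refl) refl ▹
        eentry (evar refl) refl ▹ ∎ₑ))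
      (cost κ (length Γ) w (∣p∣≤n (∁ X)) (∣p∣≤n X) (pending-initial Γ))
    where
    pending-initial : ∀ {w} (Γ : List (Implication w)) → pending (initial Γ) ≤ length Γ
    pending-initial []      = z≤n
    pending-initial (φ ∷ Γ) = s≤s (pending-initial Γ)

    cost : ∀ k h w {m d u} → m ≤ w → d ≤ w → u ≤ h → let a = suc h ; b = suc w in
      k + (2 * a * m + a * d + 2 * b * u + a + b) * (4 * k) ≤ 33 * (a * b) * k
    cost k h w {m} {d} {u} m≤w d≤w u≤h = begin
      k + (2 * a * m + a * d + 2 * b * u + a + b) * (4 * k)
        ≤⟨ +-monoʳ-≤ k (*-monoˡ-≤ (4 * k) (+-monoˡ-≤ b (+-monoˡ-≤ a (+-mono-≤ (+-mono-≤
             (*-monoʳ-≤ (2 * a) m≤w) (*-monoʳ-≤ a d≤w)) (*-monoʳ-≤ (2 * b) u≤h))))) ⟩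
      k + (2 * a * w + a * w + 2 * b * h + a + b) * (4 * k)
        ≤⟨ m≤m+n _ _ ⟩
      k + (2 * a * w + a * w + 2 * b * h + a + b) * (4 * k) + (13 * h * w + 21 * h + 17 * w + 24) * k
        ≡⟨ identity k h w ⟩
      33 * (a * b) * k ∎
      where
      open ≤-Reasoning
      a = suc h
      b = suc w
      identity : ∀ k h w → let a = suc h ; b = suc w in
        k + (2 * a * w + a * w + 2 * b * h + a + b) * (4 * k) + (13 * h * w + 21 * h + 17 * w + 24) * k
        ≡ 33 * (a * b) * k
      identity = solve-∀

-- The sets of a given size in a row

module _ {w : ℕ} where

  enumerates-none : {P : Pred (Subset w) 0ℓ} → (∀ X → ¬ P X) → [] Enumerates P
  enumerates-none ¬P = [] , λ X → mk⇔ (λ ()) (⊥-elim ∘ ¬P X)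

  enumerates-≐ : ∀ {P Q : Pred (Subset w) 0ℓ} {Xs} → P ≐ Q → Xs Enumerates P → Xs Enumerates Q
  enumerates-≐ (P⊆Q , Q⊆P) (uniq , mem) =
    uniq , λ X → mk⇔ (P⊆Q ∘ Equivalence.to (mem X)) (Equivalence.from (mem X) ∘ Q⊆P)

  enumerates-++ : ∀ {P Q : Pred (Subset w) 0ℓ} {Xs Ys} → (∀ {X} → P X → ¬ Q X) →
    Xs Enumerates P → Ys Enumerates Q → (Xs ++ Ys) Enumerates (P ∪ₚ Q)
  enumerates-++ {Xs = Xs} disjoint (uniq , mem) (uniq′ , mem′) =
    Unique.++⁺ uniq uniq′ (λ { {X} (x , y) → disjoint (Equivalence.to (mem X) x) (Equivalence.to (mem′ X) y) }) ,
    λ X → mk⇔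
      (λ x → case ∈-++⁻ Xs x of λ
        { (inj₁ x) → inj₁ (Equivalence.to (mem X) x)
        ; (inj₂ x) → inj₂ (Equivalence.to (mem′ X) x)
        })
      λ { (inj₁ p) → ∈-++⁺ˡ (Equivalence.from (mem X) p)
        ; (inj₂ q) → ∈-++⁺ʳ Xs (Equivalence.from (mem′ X) q)
        }

  enumerates-∷ : ∀ {P : Pred (Subset w) 0ℓ} {Xs} b → Xs Enumerates P →
    map (b ∷_) Xs Enumerates (λ X → ∃[ X′ ] X ≡ b ∷ X′ × P X′)
  enumerates-∷ b (uniq , mem) = Unique.map⁺ ∷-injectiveʳ uniq , λ X → mk⇔
    (λ x → case ∈-map⁻ (b ∷_) x of λ { (X′ , x , refl) → X′ , refl , Equivalence.to (mem X′) x })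
    λ { (X′ , refl , p) → ∈-map⁺ (b ∷_) (Equivalence.from (mem X′) p) }

  enumerates-nonempty : ∀ {P : Pred (Subset w) 0ℓ} {Xs X} → Xs Enumerates P → P X → 1 ≤ length Xs
  enumerates-nonempty {Xs = []}     {X} (_ , mem) p = case Equivalence.from (mem X) p of λ ()
  enumerates-nonempty {Xs = _ ∷ Xs}     _         p = s≤s z≤n

-- The conditions `O ⊆ X` and `Empty (Y ∩ X)`, read position by position to match the recursion of
-- `fillings`. There is no constructor for a position in both `O` and `Y`, so an inhabited row has
-- these disjoint.
data Row : ∀ {n} → Subset n → Subset n → Subset n → Set where
  []     : Row [] [] []
  one    : ∀ {n} {O Y X : Subset n} → Row O Y X → Row (true ∷ O) (false ∷ Y) (true ∷ X)
  nought : ∀ {n} {O Y X : Subset n} → Row O Y X → Row (false ∷ O) (true ∷ Y) (false ∷ X)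
  free   : ∀ {n} {O Y X : Subset n} {x} → Row O Y X → Row (false ∷ O) (false ∷ Y) (x ∷ X)

Row⁺ : ∀ {n} {O Y X : Subset n} → O ⊆ X → Empty (Y ∩ X) → Row O Y X
Row⁺ {O = []}        {[]}        {[]}        O⊆X Y∩X = []
Row⁺ {O = true ∷ O}  {y ∷ Y}     {false ∷ X} O⊆X Y∩X = case O⊆X here of λ ()
Row⁺ {O = o ∷ O}     {true ∷ Y}  {true ∷ X}  O⊆X Y∩X = ⊥-elim (Y∩X (zero , here))
Row⁺ {O = true ∷ O}  {false ∷ Y} {true ∷ X}  O⊆X Y∩X = one (Row⁺ (drop-∷-⊆ O⊆X) (drop-∷-Empty Y∩X))
Row⁺ {O = false ∷ O} {true ∷ Y}  {false ∷ X} O⊆X Y∩X = nought (Row⁺ (drop-∷-⊆ O⊆X) (drop-∷-Empty Y∩X))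
Row⁺ {O = false ∷ O} {false ∷ Y} {x ∷ X}     O⊆X Y∩X = free (Row⁺ (drop-∷-⊆ O⊆X) (drop-∷-Empty Y∩X))

Row⇒⊆ : ∀ {n} {O Y X : Subset n} → Row O Y X → O ⊆ X
Row⇒⊆ (one row)    here        = here
Row⇒⊆ (one row)    (there x∈O) = there (Row⇒⊆ row x∈O)
Row⇒⊆ (nought row) (there x∈O) = there (Row⇒⊆ row x∈O)
Row⇒⊆ (free row)   (there x∈O) = there (Row⇒⊆ row x∈O)

Row⇒Empty : ∀ {n} {O Y X : Subset n} → Row O Y X → Empty (Y ∩ X)
Row⇒Empty (one row)    (suc x , there x∈) = Row⇒Empty row (x , x∈)
Row⇒Empty (nought row) (suc x , there x∈) = Row⇒Empty row (x , x∈)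
Row⇒Empty (free row)   (suc x , there x∈) = Row⇒Empty row (x , x∈)

data Frees : ∀ {n} → Subset n → Subset n → ℕ → Set where
  []     : Frees [] [] 0
  one    : ∀ {n f} {O Y : Subset n} → Frees O Y f → Frees (true ∷ O) (false ∷ Y) f
  nought : ∀ {n f} {O Y : Subset n} → Frees O Y f → Frees (false ∷ O) (true ∷ Y) f
  free   : ∀ {n f} {O Y : Subset n} → Frees O Y f → Frees (false ∷ O) (false ∷ Y) (suc f)

∣X∣≤∣O∣+f : ∀ {n f} {O Y X : Subset n} → Frees O Y f → Row O Y X → ∣ X ∣ ≤ ∣ O ∣ + f
∣X∣≤∣O∣+f []         []           = z≤n
∣X∣≤∣O∣+f (one s)    (one row)    = s≤s (∣X∣≤∣O∣+f s row)
∣X∣≤∣O∣+f (nought s) (nought row) = ∣X∣≤∣O∣+f s row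
∣X∣≤∣O∣+f {O = _ ∷ O} {X = true ∷ X}  (free {f = f} s) (free row) =
  subst (suc ∣ X ∣ ≤_) (sym (+-suc ∣ O ∣ f)) (s≤s (∣X∣≤∣O∣+f s row))
∣X∣≤∣O∣+f {O = _ ∷ O} {X = false ∷ X} (free {f = f} s) (free row) =
  ≤-trans (∣X∣≤∣O∣+f s row) (+-monoʳ-≤ (∣ O ∣) (n≤1+n f))

frees : ∀ {n} {O Y X : Subset n} → Row O Y X → ∃[ f ] Frees O Y f × ∣ O ∣ + f + ∣ Y ∣ ≡ n
frees []           = 0 , [] , refl
frees (one row)    = let f , s , eq = frees row in f , one s , cong suc eq
frees (nought {O = O} {Y} row) =
  let f , s , eq = frees row in f , nought s , trans (+-suc (∣ O ∣ + f) ∣ Y ∣) (cong suc eq)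
frees (free {O = O} {Y} row) =
  let f , s , eq = frees row
  in suc f , free s , trans (cong (_+ ∣ Y ∣) (+-suc ∣ O ∣ f)) (cong suc eq)

Filling : ∀ {n} → Subset n → Subset n → ℕ → Subset n → Set
Filling O Y r X = Row O Y X × ∣ X ∣ ≡ ∣ O ∣ + r

fillings-enumerates : ∀ {n} {O Y : Subset n} {f} → Frees O Y f → ∀ r g → r + g ≡ f →
  fillings O Y r g Enumerates Filling O Y r
fillings-enumerates []         zero zero eq =
  [] ∷ [] , λ { [] → mk⇔ (λ _ → [] , refl) (λ _ → here refl) }
fillings-enumerates (one s)    r    g    eq = enumerates-≐
  ( (λ { (inj₁ (_ , refl , row , ∣X∣)) → one row , cong suc ∣X∣ ; (inj₂ ()) })
  , λ { (one row , ∣X∣) → inj₁ (_ , refl , row , suc-injective ∣X∣) } )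
  (enumerates-++ {Q = ∅} (λ _ ()) (enumerates-∷ true (fillings-enumerates s r g eq)) (enumerates-none (λ _ ())))
fillings-enumerates (nought s) r    g    eq = enumerates-≐
  ( (λ { (inj₁ (_ , refl , row , ∣X∣)) → nought row , ∣X∣ ; (inj₂ ()) })
  , λ { (nought row , ∣X∣) → inj₁ (_ , refl , row , ∣X∣) } )
  (enumerates-++ {Q = ∅} (λ _ ()) (enumerates-∷ false (fillings-enumerates s r g eq)) (enumerates-none (λ _ ())))
fillings-enumerates {suc n} {_ ∷ O} {_ ∷ Y} (free s)   r    g    eq = enumerates-≐
  ( (λ { (inj₁ (_ , refl , row , r′ , refl , ∣X∣)) → free row , trans (cong suc ∣X∣) (sym (+-suc ∣ O ∣ r′))
       ; (inj₂ (inj₁ (_ , refl , row , ∣X∣))) → free row , ∣X∣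
       ; (inj₂ (inj₂ ())) })
  , λ { {true ∷ X} (free row , ∣X∣) → inj₁ (_ , refl , row , split row ∣X∣)
      ; {false ∷ X} (free row , ∣X∣) → inj₂ (inj₁ (_ , refl , row , ∣X∣)) } )
  (enumerates-++ (λ { (_ , refl , _) (inj₁ (_ , () , _)) ; (_ , refl , _) (inj₂ ()) }) (enumerates-∷ true (left r g eq))
    (enumerates-++ {Q = ∅} (λ _ ()) (enumerates-∷ false (right r g eq)) (enumerates-none (λ _ ()))))
  where
  ∣O∣≤ : ∀ {n} {O Y X : Subset n} → Row O Y X → ∣ O ∣ ≤ ∣ X ∣
  ∣O∣≤ row = p⊆q⇒∣p∣≤∣q∣ (Row⇒⊆ row)

  split : ∀ {X r} → Row O Y X → suc ∣ X ∣ ≡ ∣ O ∣ + r → ∃[ r′ ] r ≡ suc r′ × ∣ X ∣ ≡ ∣ O ∣ + r′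
  split {X} {zero}  row eq = ⊥-elim (<-irrefl refl (≤-trans (≤-reflexive (trans eq (+-identityʳ (∣ O ∣)))) (∣O∣≤ row)))
  split {X} {suc r} row eq = r , refl , suc-injective (trans eq (+-suc (∣ O ∣) r))

  left : ∀ r g → r + g ≡ suc _ → fillings₁ O Y r g Enumerates (λ X → Row O Y X × ∃[ r′ ] r ≡ suc r′ × ∣ X ∣ ≡ ∣ O ∣ + r′)
  left zero    g eq = enumerates-none λ { X (_ , _ , () , _) }
  left (suc r) g eq = enumerates-≐
    ((λ { (row , ∣X∣) → row , r , refl , ∣X∣ }) , λ { (row , r , refl , ∣X∣) → row , ∣X∣ })
    (fillings-enumerates s r g (suc-injective eq))

  right : ∀ r g → r + g ≡ suc _ → fillings₀ O Y r g Enumerates Filling O Y r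
  -- With no false left to place, a false here would leave one free position too few for the `r`
  -- elements that are still required.
  right r zero    eq = enumerates-none λ { X (row , ∣X∣) → <-irrefl refl (≤-trans (≤-reflexive
    (trans (sym (+-suc ∣ O ∣ _)) (trans (cong (∣ O ∣ +_) (trans (sym eq) (+-identityʳ r))) (sym ∣X∣)))) (∣X∣≤∣O∣+f s row)) }
  right r (suc g) eq = fillings-enumerates s r g (suc-injective (trans (sym (+-suc r g)) eq))

length-map-++ : ∀ {A B : Set} (f : A → B) xs {ys} → length (map f xs ++ ys) ≡ length xs + length ys
length-map-++ f xs {ys} = trans (length-++ (map f xs)) (cong (_+ length ys) (length-map f xs))

fillings-nonempty : ∀ {n} {O Y : Subset n} {f} → Frees O Y f → ∀ r g → r + g ≡ f → 1 ≤ length (fillings O Y r g)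
fillings-nonempty []         zero    zero    eq = s≤s z≤n
fillings-nonempty {O = _ ∷ O} {_ ∷ Y} (one s)    r       g       eq
  rewrite length-map-++ (true Vec.∷_) (fillings O Y r g) {[]}
  = ≤-trans (fillings-nonempty s r g eq) (m≤m+n _ 0)
fillings-nonempty {O = _ ∷ O} {_ ∷ Y} (nought s) r       g       eq
  rewrite length-map-++ (false Vec.∷_) (fillings O Y r g) {[]}
  = ≤-trans (fillings-nonempty s r g eq) (m≤m+n _ 0)
fillings-nonempty (free s)   zero    zero    ()
fillings-nonempty {O = _ ∷ O} {_ ∷ Y} (free s)   (suc r) g       eq
  rewrite length-map-++ (true Vec.∷_) (fillings O Y r g) {map (false ∷_) (fillings₀ O Y (suc r) g) ++ []}
  = ≤-trans (fillings-nonempty s r g (suc-injective eq)) (m≤m+n _ _)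
fillings-nonempty {O = _ ∷ O} {_ ∷ Y} (free s)   zero    (suc g) eq
  rewrite length-map-++ (false Vec.∷_) (fillings O Y 0 g) {[]}
  = ≤-trans (fillings-nonempty s 0 g (suc-injective eq)) (m≤m+n _ 0)

fixed-cost : ∀ {n} b (Xs : List (Subset n)) → 1 ≤ length Xs →
  κ + length Xs * (suc n * (4 * κ)) + suc (length Xs) * κ
    ≤ length (map (b Vec.∷_) Xs ++ []) * (suc (suc n) * (4 * κ))
fixed-cost {n} b Xs 1≤N rewrite length-map-++ (b Vec.∷_) Xs {[]} with N , eq ← m≤n⇒∃[o]m+o≡n 1≤N
  rewrite sym eq = ≤-slack ((1 + 3 * N) * κ) (identity κ n N)
  where
  identity : ∀ k n N → k + suc N * (suc n * (4 * k)) + suc (suc N) * k + (1 + 3 * N) * k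
    ≡ (suc N + 0) * (suc (suc n) * (4 * k))
  identity = solve-∀

-- Besides the recursive calls, a node costs x + y + 3 times `κ`: itself, and two copying passes
-- with their ends. Since x + y ≥ 1, this is at most 4 `κ` per listed set, the origin of the factor
-- 4.
free-cost : ∀ {n} (Xs Ys : List (Subset n)) → 1 ≤ length Xs + length Ys →
  κ + length Xs * (suc n * (4 * κ)) + length Ys * (suc n * (4 * κ)) + suc (length Ys) * κ + suc (length Xs) * κ
    ≤ length (map (true Vec.∷_) Xs ++ (map (false Vec.∷_) Ys ++ [])) * (suc (suc n) * (4 * κ))
free-cost {n} Xs Ys 1≤N
  rewrite length-map-++ (true Vec.∷_) Xs {map (false Vec.∷_) Ys ++ []} | length-map-++ (false Vec.∷_) Ys {[]}
  = cost (length Xs) (length Ys) 1≤N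
  where
  identity₁ : ∀ k n x y →
    (k + suc x * (suc n * (4 * k)) + y * (suc n * (4 * k)) + suc y * k + suc (suc x) * k) + (3 * x + 3 * y) * k
      ≡ (suc x + (y + 0)) * (suc (suc n) * (4 * k))
  identity₁ = solve-∀
  identity₂ : ∀ k n y →
    (k + 0 * (suc n * (4 * k)) + suc y * (suc n * (4 * k)) + suc (suc y) * k + 1 * k) + 3 * y * k
      ≡ (suc y + 0) * (suc (suc n) * (4 * k))
  identity₂ = solve-∀
  cost : ∀ x y → 1 ≤ x + y →
    κ + x * (suc n * (4 * κ)) + y * (suc n * (4 * κ)) + suc y * κ + suc x * κ
      ≤ (x + (y + 0)) * (suc (suc n) * (4 * κ))
  cost (suc x) y       _ = ≤-slack ((3 * x + 3 * y) * κ) (identity₁ κ n x y)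
  cost zero    (suc y) _ = ≤-slack (3 * y * κ) (identity₂ κ n y)

module Enumerating (P : Program) where
  open Machine P
  open Procedures P

  runs-enum : ∀ {n} {O Y : Subset n} {f} → Frees O Y f → ∀ r g → r + g ≡ f →
    Runs enum (encSubset O ∷ encSubset Y ∷ nat r ∷ nat g ∷ [])
      (encSubsets (fillings O Y r g)) (length (fillings O Y r g) * (suc n * (4 * κ)))
  runs-enum [] r g eq = within (eifnil refl (econs enil enil)) (≤-slack (3 * κ) (cost κ))
    where
    cost : ∀ k → k + 3 * k ≡ 1 * (1 * (4 * k))
    cost = solve-∀
  runs-enum {O = _ ∷ O} {_ ∷ Y} (one s) r g eq = within (eifcons refl (eif+ (ehd refl)
    (ecall (runs-consEach true (fillings O Y r g) {[]}) (elit ▹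
      ecall (runs-enum s r g eq) (etl refl ▹ etl refl ▹ evar refl ▹ evar refl ▹ ∎ₑ) ▹ enil ▹ ∎ₑ))))
    (fixed-cost true (fillings O Y r g) (fillings-nonempty s r g eq))
  runs-enum {O = _ ∷ O} {_ ∷ Y} (nought s) r g eq = within (eifcons refl (eif0 (ehd refl) (eif+ (ehd refl)
    (ecall (runs-consEach false (fillings O Y r g) {[]}) (elit ▹
      ecall (runs-enum s r g eq) (etl refl ▹ etl refl ▹ evar refl ▹ evar refl ▹ ∎ₑ) ▹ enil ▹ ∎ₑ)))))
    (fixed-cost false (fillings O Y r g) (fillings-nonempty s r g eq))
  runs-enum (free s) zero zero ()
  runs-enum {O = _ ∷ O} {_ ∷ Y} (free s) (suc r) zero eq =
    within (eifcons refl (eif0 (ehd refl) (eif0 (ehd refl)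
      (ecall (runs-consEach true (fillings O Y r 0) {map (false ∷_) [] ++ []}) (elit ▹
        eif+ (evar refl) (ecall (runs-enum s r 0 (suc-injective eq))
          (etl refl ▹ etl refl ▹ esub (evar refl) elit ▹ evar refl ▹ ∎ₑ)) ▹
        ecall (runs-consEach false (fillings₀ O Y (suc r) 0) {[]}) (elit ▹ eif0 (evar refl) (idle enil) ▹ enil ▹ ∎ₑ) ▹ ∎ₑ)))))
      (free-cost (fillings O Y r 0) [] (≤-trans (fillings-nonempty s r 0 (suc-injective eq)) (m≤m+n _ 0)))
  runs-enum {O = _ ∷ O} {_ ∷ Y} (free s) zero (suc g) eq =
    within (eifcons refl (eif0 (ehd refl) (eif0 (ehd refl)
      (ecall (runs-consEach true (fillings₁ O Y 0 (suc g)) {map (false ∷_) (fillings O Y 0 g) ++ []}) (elit ▹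
        eif0 (evar refl) (idle enil) ▹
        ecall (runs-consEach false (fillings O Y 0 g) {[]}) (elit ▹ eif+ (evar refl)
          (ecall (runs-enum s 0 g (suc-injective eq))
            (etl refl ▹ etl refl ▹ evar refl ▹ esub (evar refl) elit ▹ ∎ₑ)) ▹ enil ▹ ∎ₑ) ▹ ∎ₑ)))))
      (free-cost [] (fillings O Y 0 g) (fillings-nonempty s 0 g (suc-injective eq)))
  runs-enum {O = _ ∷ O} {_ ∷ Y} (free s) (suc r) (suc g) eq =
    within (eifcons refl (eif0 (ehd refl) (eif0 (ehd refl)
      (ecall (runs-consEach true (fillings O Y r (suc g)) {map (false ∷_) (fillings O Y (suc r) g) ++ []}) (elit ▹
        eif+ (evar refl) (ecall (runs-enum s r (suc g) (suc-injective eq))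
          (etl refl ▹ etl refl ▹ esub (evar refl) elit ▹ evar refl ▹ ∎ₑ)) ▹
        ecall (runs-consEach false (fillings O Y (suc r) g) {[]}) (elit ▹ eif+ (evar refl)
          (ecall (runs-enum s (suc r) g eq′)
            (etl refl ▹ etl refl ▹ evar refl ▹ esub (evar refl) elit ▹ ∎ₑ)) ▹ enil ▹ ∎ₑ) ▹ ∎ₑ)))))
      (free-cost (fillings O Y r (suc g)) (fillings O Y (suc r) g)
        (≤-trans (fillings-nonempty s r (suc g) (suc-injective eq)) (m≤m+n _ _)))
    where eq′ = suc-injective (trans (cong suc (sym (+-suc r g))) eq)

-- The search

-- The share of one solution on one level. The 42 is dictated by `main-cost`, whose multiples of `κ`
-- add up to 1 + 2 + 2 + 1 + 2 + 33 + 1 when `h` and `w` are 0; a node needs only 40.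
searchUnit : (h w q : ℕ) → ℕ
searchUnit h w q = 42 * (suc h * suc w) * κ + 2 * q

leaf-cost : ∀ k h w q N → 1 ≤ N →
  k + suc w * k + suc w * k + N * (suc w * (4 * k)) ≤ N * (1 * (42 * (suc h * suc w) * k + 2 * q))
leaf-cost k h w q (suc n) _ =
  ≤-slack ((42 * suc n * h * suc w + 38 * n * suc w + 36 * w + 35) * k + 2 * q * suc n) (identity k h w q n)
  where
  identity : ∀ k h w q n →
    k + suc w * k + suc w * k + suc n * (suc w * (4 * k))
      + ((42 * suc n * h * suc w + 38 * n * suc w + 36 * w + 35) * k + 2 * q * suc n)
    ≡ suc n * (1 * (42 * (suc h * suc w) * k + 2 * q))
  identity = solve-∀

-- `x` is the cost per solution below the node. One child may be empty, and then causes only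
-- `k + q`; since the node itself has a solution, this and the closure can be charged to it.
node-cost : ∀ k h w q x N₁ N₂ → 1 ≤ N₁ + N₂ →
  k + suc w * k + (k + q + N₁ * x) + suc w * k + 33 * (suc h * suc w) * k + (k + q + N₂ * x) + suc N₁ * k
    ≤ (N₁ + N₂) * (42 * (suc h * suc w) * k + 2 * q + x)
node-cost k h w q x N₁ N₂ 1≤N with n , eq ← m≤n⇒∃[o]m+o≡n 1≤N = begin
  k + suc w * k + (k + q + N₁ * x) + suc w * k + 33 * (suc h * suc w) * k + (k + q + N₂ * x) + suc N₁ * k
    ≤⟨ ≤-slack (N₂ * k) (identity₁ k h w q x N₁ N₂) ⟩
  (4 + 2 * suc w + 33 * (suc h * suc w) + (N₁ + N₂)) * k + 2 * q + (N₁ + N₂) * x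
    ≡⟨ cong (λ N → (4 + 2 * suc w + 33 * (suc h * suc w) + N) * k + 2 * q + N * x) eq ⟨
  (4 + 2 * suc w + 33 * (suc h * suc w) + suc n) * k + 2 * q + suc n * x
    ≤⟨ ≤-slack ((n * (42 * h * suc w + 42 * w + 41) + 9 * h * suc w + 7 * w + 2) * k + 2 * q * n)
         (identity₂ k h w q x n) ⟩
  suc n * (42 * (suc h * suc w) * k + 2 * q + x)
    ≡⟨ cong (_* (42 * (suc h * suc w) * k + 2 * q + x)) eq ⟩
  (N₁ + N₂) * (42 * (suc h * suc w) * k + 2 * q + x) ∎
  where
  open ≤-Reasoning
  identity₁ : ∀ k h w q x N₁ N₂ →
    k + suc w * k + (k + q + N₁ * x) + suc w * k + 33 * (suc h * suc w) * k + (k + q + N₂ * x) + suc N₁ * k + N₂ * k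
    ≡ (4 + 2 * suc w + 33 * (suc h * suc w) + (N₁ + N₂)) * k + 2 * q + (N₁ + N₂) * x
  identity₁ = solve-∀
  identity₂ : ∀ k h w q x n →
    (4 + 2 * suc w + 33 * (suc h * suc w) + suc n) * k + 2 * q + suc n * x
      + ((n * (42 * h * suc w + 42 * w + 41) + 9 * h * suc w + 7 * w + 2) * k + 2 * q * n)
    ≡ suc n * (42 * (suc h * suc w) * k + 2 * q + x)
  identity₂ = solve-∀

remaining-free : ∀ {w o f y} k → o + f + y ≡ w → o ≤ k → k ≤ o + f → (k ∸ o) + (w ∸ y ∸ k) ≡ f
remaining-free {o = o} {f} {y} k refl o≤k k≤o+f with r , refl ← m≤n⇒∃[o]m+o≡n o≤k = begin
  (o + r ∸ o) + (o + f + y ∸ y ∸ (o + r))  ≡⟨ cong₂ (λ i j → i + (j ∸ (o + r))) (m+n∸m≡n o r) (m+n∸n≡m (o + f) y) ⟩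
  r + (o + f ∸ (o + r))                    ≡⟨ cong (r +_) ([m+n]∸[m+o]≡n∸o o f r) ⟩
  r + (f ∸ r)                              ≡⟨ m+[n∸m]≡n (+-cancelˡ-≤ o r f k≤o+f) ⟩
  f                                        ∎
  where open ≡-Reasoning

module Search (P : Program) {w : ℕ} (C : ClosureSystem w) (Γ : List (Implication w)) (base : Γ IsBaseOf C)
    (code : Val) (k q : ℕ)
    (oracle-runs : ∀ O Y → Closed C O → Σ[ d ∈ Dec (DisjointExtension C O Y k) ]
      Machine.Runs P oracle (code ∷ nat w ∷ encSubset O ∷ encSubset Y ∷ nat k ∷ []) (encBool (does d)) q) where
  open Machine P
  open Procedures P
  open Closing P
  open Enumerating P

  context : Val
  context = block (code ∷ nat w ∷ nat k ∷ encColumns (transposed Γ) ∷ encCounters (initial Γ) ∷ encImplications Γ ∷ [])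

  unit : ℕ
  unit = searchUnit (length Γ) w q

  Solution : Subset w → Subset w → Pred (Subset w) 0ℓ
  Solution O Y X = Row O Y X × Closed C X × ∣ X ∣ ≡ k

  -- The three cases may overlap. An element occurring in several premises is branched on again
  -- after it has been decided; one of the two rows is then empty and the test rejects it.
  Covered : List (Fin w) → Subset w → Subset w → Set
  Covered as O Y = ∀ {φ} → φ ∈ₗ Γ → ∀ {a} → a ∈ₛ premise φ → a ∈ₗ as ⊎ a ∈ₛ O ⊎ a ∈ₛ Y

  Row⇒closed : ∀ {O Y X} → Closed C O → Covered [] O Y → Row O Y X → Closed C X
  Row⇒closed {O} {Y} {X} O-closed covered row = proj₂ base (All.tabulate step)
    where
    step : ∀ {φ} → φ ∈ₗ Γ → X Satisfies φ
    step {φ} φ∈Γ A⊆X = Row⇒⊆ row ∘ All.lookup (proj₁ base O-closed) φ∈Γ A⊆O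
      where
      A⊆O : premise φ ⊆ O
      A⊆O x∈A with covered φ∈Γ x∈A
      ... | inj₂ (inj₁ x∈O) = x∈O
      ... | inj₂ (inj₂ x∈Y) = ⊥-elim (Row⇒Empty row (_ , x∈p∩q⁺ (x∈Y , A⊆X x∈A)))

  extension⇒solution : ∀ {O Y} → DisjointExtension C O Y k → ∃[ X ] Solution O Y X
  extension⇒solution (Z , Z-closed , O⊆Z , ∣Z∣ , Y∩Z) = Z , Row⁺ O⊆Z Y∩Z , Z-closed , ∣Z∣

  solution⇒extension : ∀ {O Y X} → Solution O Y X → DisjointExtension C O Y k
  solution⇒extension {X = X} (row , closed , ∣X∣) = X , closed , Row⇒⊆ row , ∣X∣ , Row⇒Empty row

  inserted∈ : ∀ {O Ô a} → IsClosure Γ (O ∪ ⁅ a ⁆) Ô → a ∈ₛ Ô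
  inserted∈ {O} {a = a} closure = IsClosure.⊇ closure (q⊆p∪q O ⁅ a ⁆ (x∈⁅x⁆ a))

  inserted∉ : ∀ {O Y X : Subset w} {a} → Row O (Y ∪ ⁅ a ⁆) X → a ∉ₛ X
  inserted∉ {Y = Y} {a = a} row a∈X = Row⇒Empty row (a , x∈p∩q⁺ (q⊆p∪q Y ⁅ a ⁆ (x∈⁅x⁆ a) , a∈X))

  module _ {O Y Ô : Subset w} {a : Fin w} (closure : IsClosure Γ (O ∪ ⁅ a ⁆) Ô) where
    open IsClosure closure

    split : (Solution O (Y ∪ ⁅ a ⁆) ∪ₚ Solution Ô Y) ≐ Solution O Y
    split = ⇒ , ⇐
      where
      ⇒ : ∀ {X} → (Solution O (Y ∪ ⁅ a ⁆) ∪ₚ Solution Ô Y) X → Solution O Y X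
      ⇒ {X} (inj₁ (row , closed , ∣X∣)) = Row⁺ (Row⇒⊆ row) (λ { (x , x∈) →
        let x∈Y , x∈X = x∈p∩q⁻ Y X x∈
        in Row⇒Empty row (x , x∈p∩q⁺ (p⊆p∪q ⁅ a ⁆ x∈Y , x∈X)) }) , closed , ∣X∣
      ⇒ {X} (inj₂ (row , closed , ∣X∣)) =
        Row⁺ (Row⇒⊆ row ∘ ⊇ ∘ p⊆p∪q ⁅ a ⁆) (Row⇒Empty row) , closed , ∣X∣

      ⇐ : ∀ {X} → Solution O Y X → (Solution O (Y ∪ ⁅ a ⁆) ∪ₚ Solution Ô Y) X
      ⇐ {X} (row , X-closed , ∣X∣) with a ∈? X
      -- As a model of `Γ` containing `O` and `a`, the set contains their closure `Ô`.
      ... | yes a∈X = inj₂ (Row⁺ (least O+a⊆X (proj₁ base X-closed)) (Row⇒Empty row) , X-closed , ∣X∣)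
        where
        O+a⊆X : O ∪ ⁅ a ⁆ ⊆ X
        O+a⊆X x∈ with x∈p∪q⁻ O ⁅ a ⁆ x∈
        ... | inj₁ x∈O = Row⇒⊆ row x∈O
        ... | inj₂ x∈a = subst (_∈ₛ X) (sym (x∈⁅y⁆⇒x≡y a x∈a)) a∈X
      ... | no a∉X = inj₁ (Row⁺ (Row⇒⊆ row) Y+a∩X , X-closed , ∣X∣)
        where
        Y+a∩X : Empty ((Y ∪ ⁅ a ⁆) ∩ X)
        Y+a∩X (x , x∈) with x∈p∩q⁻ (Y ∪ ⁅ a ⁆) X x∈
        ... | x∈Y+a , x∈X with x∈p∪q⁻ Y ⁅ a ⁆ x∈Y+a
        ... | inj₁ x∈Y = Row⇒Empty row (x , x∈p∩q⁺ (x∈Y , x∈X))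
        ... | inj₂ x∈a = a∉X (subst (_∈ₛ X) (x∈⁅y⁆⇒x≡y a x∈a) x∈X)

    covered-out : ∀ {as} → Covered (a ∷ as) O Y → Covered as O (Y ∪ ⁅ a ⁆)
    covered-out covered φ∈Γ x∈A with covered φ∈Γ x∈A
    ... | inj₁ (here refl)   = inj₂ (inj₂ (q⊆p∪q Y ⁅ a ⁆ (x∈⁅x⁆ a)))
    ... | inj₁ (there x∈as)  = inj₁ x∈as
    ... | inj₂ (inj₁ x∈O)    = inj₂ (inj₁ x∈O)
    ... | inj₂ (inj₂ x∈Y)    = inj₂ (inj₂ (p⊆p∪q ⁅ a ⁆ x∈Y))

    covered-in : ∀ {as} → Covered (a ∷ as) O Y → Covered as Ô Y
    covered-in covered φ∈Γ x∈A with covered φ∈Γ x∈A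
    ... | inj₁ (here refl)   = inj₂ (inj₁ (inserted∈ closure))
    ... | inj₁ (there x∈as)  = inj₁ x∈as
    ... | inj₂ (inj₁ x∈O)    = inj₂ (inj₁ (⊇ (p⊆p∪q ⁅ a ⁆ x∈O)))
    ... | inj₂ (inj₂ x∈Y)    = inj₂ (inj₂ x∈Y)

  -- Only rows known to contain a solution are searched, so the cost is a pure multiple of the
  -- number of solutions; the cost of the test appears in `runs-visit`, whose row may be empty.
  runs-search : ∀ as O Y → Closed C O → Covered as O Y → DisjointExtension C O Y k →
    ∃[ Xs ] Xs Enumerates Solution O Y ×
      Runs search (encFins as ∷ encSubset O ∷ encSubset Y ∷ context ∷ []) (encSubsets Xs)
        (length Xs * (suc (length as) * unit))

  runs-visit : ∀ as O Y → Closed C O → Covered as O Y →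
    ∃[ Xs ] Xs Enumerates Solution O Y ×
      Runs visit (encFins as ∷ encSubset O ∷ encSubset Y ∷ context ∷ []) (encSubsets Xs)
        (κ + q + length Xs * (suc (length as) * unit))

  runs-search [] O Y O-closed covered extension =
    let Z , row , Z-closed , ∣Z∣ = extension⇒solution extension
        -- The solution shows that `O` and `Y` are disjoint and that k lies between |O| and |O| + f,
        -- which makes the truncated subtractions exact.
        f , s , f≡ = frees row
        O≤k = subst (∣ O ∣ ≤_) ∣Z∣ (p⊆q⇒∣p∣≤∣q∣ (Row⇒⊆ row))
        k≤O+f = subst (_≤ ∣ O ∣ + f) ∣Z∣ (∣X∣≤∣O∣+f s row)
        r = k ∸ ∣ O ∣
        g = w ∸ ∣ Y ∣ ∸ k
        r+g≡f = remaining-free k f≡ O≤k k≤O+f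
        O+r≡k = m+[n∸m]≡n O≤k
    in fillings O Y r g
     , enumerates-≐
         ( (λ { (row , ∣X∣) → row , Row⇒closed O-closed covered row , trans ∣X∣ O+r≡k })
         , (λ { (row , _ , ∣X∣) → row , trans ∣X∣ (sym O+r≡k) }) )
         (fillings-enumerates s r g r+g≡f)
     , within (eifnil refl (ecall (runs-enum s r g r+g≡f) (evar refl ▹ evar refl ▹
         esub (eentry (evar refl) refl) (ecall (runs-count O) (evar refl ▹ ∎ₑ)) ▹
         esub (esub (eentry (evar refl) refl) (ecall (runs-count Y) (evar refl ▹ ∎ₑ))) (eentry (evar refl) refl) ▹ ∎ₑ)))
         (leaf-cost κ (length Γ) w q _ (fillings-nonempty s r g r+g≡f))
  runs-search (a ∷ as) O Y O-closed covered extension =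
    let Ô , closure , closing = runs-close Γ (O ∪ ⁅ a ⁆)
        Ô-closed = proj₂ base (IsClosure.closed closure)
        Xs₁ , enum₁ , visiting₁ = runs-visit as O (Y ∪ ⁅ a ⁆) O-closed (covered-out closure covered)
        Xs₂ , enum₂ , visiting₂ = runs-visit as Ô Y Ô-closed (covered-in closure covered)
        solutions = enumerates-≐ (split closure) (enumerates-++
          (λ { (row₁ , _) (row₂ , _) → inserted∉ row₁ (Row⇒⊆ row₂ (inserted∈ closure)) }) enum₁ enum₂)
        1≤N = subst (1 ≤_) (length-++ Xs₁) (enumerates-nonempty solutions (proj₂ (extension⇒solution extension)))
    in Xs₁ ++ Xs₂ , solutions
     , within (eifcons refl (ecall (runs-append Xs₁ {Xs₂}) (
         ecall visiting₁ (etl refl ▹ evar refl ▹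
           ecall (runs-insert a Y) (ehd refl ▹ evar refl ▹ ∎ₑ) ▹ evar refl ▹ ∎ₑ) ▹
         ecall visiting₂ (etl refl ▹
           ecall closing (ecall (runs-insert a O) (ehd refl ▹ evar refl ▹ ∎ₑ) ▹ evar refl ▹ ∎ₑ) ▹
           evar refl ▹ evar refl ▹ ∎ₑ) ▹ ∎ₑ)))
         (≤-trans (node-cost κ (length Γ) w q (suc (length as) * unit) (length Xs₁) (length Xs₂) 1≤N)
           (≤-reflexive (cong (_* (unit + suc (length as) * unit)) (sym (length-++ Xs₁)))))

  runs-visit as O Y O-closed covered with oracle-runs O Y O-closed
  ... | yes extension , asking =
    let Xs , solutions , searching = runs-search as O Y O-closed covered extension
    in Xs , solutions , within (eif+
      (ecall asking (eentry (evar refl) refl ▹ eentry (evar refl) refl ▹ evar refl ▹ evar refl ▹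
        eentry (evar refl) refl ▹ ∎ₑ))
      (ecall searching (evar refl ▹ evar refl ▹ evar refl ▹ evar refl ▹ ∎ₑ))) ≤-refl
  ... | no ¬extension , asking =
    [] , enumerates-none (λ X solution → ¬extension (solution⇒extension solution)) , within (eif0
      (ecall asking (eentry (evar refl) refl ▹ eentry (evar refl) refl ▹ evar refl ▹ evar refl ▹
        eentry (evar refl) refl ▹ ∎ₑ))
      enil) (m≤m+n (κ + q) 0)

-- The depth of the search and the total cost

length-elements : ∀ {n} (X : Subset n) → length (elements X) ≡ ∣ X ∣
length-elements []          = refl
length-elements (false ∷ X) = trans (length-map suc (elements X)) (length-elements X)
length-elements (true ∷ X)  = cong suc (trans (length-map suc (elements X)) (length-elements X))

∈-elements : ∀ {n} {X : Subset n} {a} → a ∈ₛ X → a ∈ₗ elements X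
∈-elements here                          = here refl
∈-elements {X = false ∷ X} (there a∈X) = ∈-map⁺ suc (∈-elements a∈X)
∈-elements {X = true ∷ X}  (there a∈X) = there (∈-map⁺ suc (∈-elements a∈X))

∈-premiseElements : ∀ {w} {Γ : List (Implication w)} {φ} → φ ∈ₗ Γ →
  ∀ {a} → a ∈ₛ premise φ → a ∈ₗ premiseElements Γ
∈-premiseElements {Γ = φ ∷ Γ} (here refl) a∈A = ∈-++⁺ˡ (∈-elements a∈A)
∈-premiseElements {Γ = ψ ∷ Γ} (there φ∈Γ) a∈A = ∈-++⁺ʳ (elements (premise ψ)) (∈-premiseElements φ∈Γ a∈A)

-- Every premise has at most s - 1 elements. One of the h units saved in this way pays for the level
-- of the leaves in `branches≤`.
premiseElements≤ : ∀ {w} (Γ : List (Implication w)) {s} → All (λ φ → ∣ premise φ ∣ + 1 ≤ s) Γ →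
  length (premiseElements Γ) + length Γ ≤ length Γ * s
premiseElements≤ []      []       = z≤n
premiseElements≤ (φ ∷ Γ) {s} (p ∷ ps) = begin
  length (elements A ++ premiseElements Γ) + suc (length Γ)
    ≡⟨ cong (_+ suc (length Γ)) (length-++ (elements A)) ⟩
  length (elements A) + length (premiseElements Γ) + suc (length Γ)
    ≡⟨ cong (λ l → l + length (premiseElements Γ) + suc (length Γ)) (length-elements A) ⟩
  ∣ A ∣ + length (premiseElements Γ) + suc (length Γ)
    ≡⟨ rearrange ∣ A ∣ (length (premiseElements Γ)) (length Γ) ⟩
  (∣ A ∣ + 1) + (length (premiseElements Γ) + length Γ)
    ≤⟨ +-mono-≤ p (premiseElements≤ Γ ps) ⟩
  s + length Γ * s ∎
  where
  open ≤-Reasoning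
  A = premise φ
  rearrange : ∀ a b c → a + b + suc c ≡ (a + 1) + (b + c)
  rearrange = solve-∀

premise<max : ∀ {w} (Γ : List (Implication w)) → All (λ φ → ∣ premise φ ∣ + 1 ≤ maxPremise+1 Γ) Γ
premise<max Γ = map⁻ (xs≤max 0 (map (λ φ → ∣ premise φ ∣ + 1) Γ))

branches≤ : ∀ {w} (Γ : List (Implication w)) → 1 ≤ length Γ →
  suc (length (premiseElements Γ)) ≤ length Γ * maxPremise+1 Γ
branches≤ Γ 1≤h = ≤-trans (≤-reflexive (+-comm 1 _))
  (≤-trans (+-monoʳ-≤ _ 1≤h) (premiseElements≤ Γ (premise<max Γ)))

encSubset-⊥ : ∀ n → encList (toList (Vec.replicate n (nat 0))) ≡ encSubset (⊥ {n})
encSubset-⊥ zero    = refl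
encSubset-⊥ (suc n) = cong (λ v → block (nat 0 ∷ v ∷ [])) (encSubset-⊥ n)

-- The tables, the first closure and the first test are paid by the 1 in `N + 1`, so the bound also
-- holds without any solution.
main-cost : ∀ h w q N x → searchUnit h w q ≤ x →
  κ + suc h * (2 * suc w * κ) + suc h * (2 * suc w * κ) + suc w * κ + suc h * (2 * suc w * κ)
    + 33 * (suc h * suc w) * κ + (κ + q + N * x) ≤ (N + 1) * x
main-cost h w q N x unit≤x = begin
  κ + suc h * (2 * suc w * κ) + suc h * (2 * suc w * κ) + suc w * κ + suc h * (2 * suc w * κ)
    + 33 * (suc h * suc w) * κ + (κ + q + N * x)
    ≤⟨ ≤-slack ((3 * h * suc w + 2 * w) * κ + q) (identity κ h w q N x) ⟩
  N * x + searchUnit h w q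
    ≤⟨ +-monoʳ-≤ (N * x) unit≤x ⟩
  N * x + x
    ≡⟨ trans (+-comm (N * x) x) (cong (_* x) (+-comm 1 N)) ⟩
  (N + 1) * x ∎
  where
  open ≤-Reasoning
  identity : ∀ k h w q N x →
    k + suc h * (2 * suc w * k) + suc h * (2 * suc w * k) + suc w * k + suc h * (2 * suc w * k)
      + 33 * (suc h * suc w) * k + (k + q + N * x) + ((3 * h * suc w + 2 * w) * k + q)
    ≡ N * x + (42 * (suc h * suc w) * k + 2 * q)
  identity = solve-∀

-- For positive h and w, (h + 1)(w + 1) is at most 4 h w, and 168 is 4 times 42.
searchUnit≤ : ∀ h w K p → 1 ≤ h → 1 ≤ w →
  searchUnit h w (K * p) ≤ (168 * κ + 2 * K) * (h * w + p)
searchUnit≤ (suc h) (suc w) K p _ _ =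
  ≤-slack ((126 * (h * w) + 84 * (h + w)) * κ + 168 * κ * p + 2 * K * (suc h * suc w)) (identity κ h w K p)
  where
  identity : ∀ k h w K p → 42 * (suc (suc h) * suc (suc w)) * k + 2 * (K * p)
      + ((126 * (h * w) + 84 * (h + w)) * k + 168 * k * p + 2 * K * (suc h * suc w))
    ≡ (168 * k + 2 * K) * (suc h * suc w + p)
  identity = solve-∀

theorem2 :
    (F : Family) (c : ℕ) → DisjointExtensionProperty F c →
    Σ[ A ∈ Program ] Σ[ K ∈ ℕ ]
      ∀ (i : Index F) (Γ : List (Implication (card F i))) (k : ℕ) →
      let w = card F i
          C = system F i
          h = length Γ
          s = maxPremise+1 Γ
      in
      Γ IsBaseOf C → 1 ≤ h → 1 ≤ k → k ≤ w →
      Σ[ Xs ∈ List (Subset w) ]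
        Xs Enumerates (λ X → X ∈ Closed C × ∣ X ∣ ≡ k) ×
        A On code F i ∷ nat w ∷ encImplications Γ ∷ nat k ∷ []
          Returns encSubsets Xs
          Within (K * ((length Xs + 1) * h * s * (h * w + w ^ c)))
theorem2 F c (_ , P , K , oracle-runs) = algorithm , 168 * κ + 2 * K , correct
  where
  open Machine P
  open Procedures P
  open Closing P

  correct : ∀ (i : Index F) (Γ : List (Implication (card F i))) (k : ℕ) →
    let w = card F i
        C = system F i
        h = length Γ
        s = maxPremise+1 Γ
    in
    Γ IsBaseOf C → 1 ≤ h → 1 ≤ k → k ≤ w →
    Σ[ Xs ∈ List (Subset w) ]
      Xs Enumerates (λ X → X ∈ Closed C × ∣ X ∣ ≡ k) ×
      algorithm On code F i ∷ nat w ∷ encImplications Γ ∷ nat k ∷ []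
        Returns encSubsets Xs
        Within ((168 * κ + 2 * K) * ((length Xs + 1) * h * s * (h * w + w ^ c)))
  correct i Γ k base 1≤h 1≤k k≤w =
    let Ô , closure , closing = runs-close Γ ⊥
        open IsClosure closure
        Xs , solutions , visiting = runs-visit (premiseElements Γ) Ô ⊥ (proj₂ base closed)
          (λ φ∈Γ a∈A → inj₁ (∈-premiseElements φ∈Γ a∈A))
    in Xs
     , enumerates-≐
         ( (λ { (_ , X-closed , ∣X∣) → X-closed , ∣X∣ })
         -- Every closed set contains the closure of the empty set, so the initial row contains all
         -- solutions.
         , (λ { (X-closed , ∣X∣) → Row⁺ (least (⊥⊆ {p = _}) (proj₁ base X-closed))
             (λ { (x , x∈) → ∉⊥ (p∩q⊆p ⊥ _ x∈) }) , X-closed , ∣X∣ }) )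
         solutions
     , returns (ebind
         (enew (evar refl ▹ evar refl ▹ evar refl ▹
           ecall (runs-columns Γ) (evar refl ▹ evar refl ▹ ∎ₑ) ▹
           ecall (runs-counters Γ) (evar refl ▹ ∎ₑ) ▹ evar refl ▹ ∎ₑ))
         (ebind (ecall replicating (evar refl ▹ elit ▹ ∎ₑ))
           (ecall visiting (ecall (runs-branches Γ) (evar refl ▹ ∎ₑ) ▹
             ecall closing (evar refl ▹ evar refl ▹ ∎ₑ) ▹ evar refl ▹ evar refl ▹ ∎ₑ))))
         (cost (length Xs))
    where
    w = card F i
    C = system F i
    h = length Γ
    s = maxPremise+1 Γ
    q = K * w ^ c

    -- The oracle makes its promise for nonempty universes, and 1 ≤ k ≤ w provides one.
    1≤w : 1 ≤ w
    1≤w = ≤-trans 1≤k k≤w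

    asking : ∀ O Y → Closed C O → Σ[ d ∈ Dec (DisjointExtension C O Y k) ]
      Runs oracle (code F i ∷ nat w ∷ encSubset O ∷ encSubset Y ∷ nat k ∷ []) (encBool (does d)) q
    asking O Y O-closed =
      let d , answers = oracle-runs i 1≤w O Y k O-closed k≤w in d , runs-oracle answers

    open Search P C Γ base (code F i) k q asking

    replicating : Runs replicate (nat w ∷ nat 0 ∷ []) (encSubset (⊥ {w})) (suc w * κ)
    replicating = subst (λ v → Runs replicate (nat w ∷ nat 0 ∷ []) v (suc w * κ)) (encSubset-⊥ w)
      (runs-replicate w (nat 0))

    depth = suc (length (premiseElements Γ))

    cost : ∀ N →
      κ + suc h * (2 * suc w * κ) + suc h * (2 * suc w * κ) + suc w * κ + suc h * (2 * suc w * κ)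
        + 33 * (suc h * suc w) * κ + (κ + q + N * (depth * unit))
        ≤ (168 * κ + 2 * K) * ((N + 1) * h * s * (h * w + w ^ c))
    cost N = begin
      _
        ≤⟨ main-cost h w q N (depth * unit) (m≤m+n unit _) ⟩
      (N + 1) * (depth * unit)
        ≤⟨ *-monoʳ-≤ (N + 1) (*-mono-≤ (branches≤ Γ 1≤h) (searchUnit≤ h w K (w ^ c) 1≤h 1≤w)) ⟩
      (N + 1) * (h * s * ((168 * κ + 2 * K) * (h * w + w ^ c)))
        ≡⟨ rearrange (N + 1) h s (168 * κ + 2 * K) (h * w + w ^ c) ⟩
      (168 * κ + 2 * K) * ((N + 1) * h * s * (h * w + w ^ c)) ∎
      where
      open ≤-Reasoning
      rearrange : ∀ a b c d e → a * (b * c * (d * e)) ≡ d * (a * b * c * e)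
      rearrange = solve-∀
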